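{- Let $p$ be a prime, $G$ a profinite group and $G(p)$ its maximal pro-$p$ quotient. Then $G$ has the $p$-Kijima--Nishi property if and only if $G(p)$ has the $p$-Kijima--Nishi property.
   Context: For a profinite group $G$, $\mathrm{H}^n(G,\mathbb{F}_p)$ is continuous cohomology with trivial coefficients and $$\mathcal{R}_p(G)=\{\alpha\in \mathrm{H}^1(G,\mathbb{F}_p) : \alpha\smile\beta=0 \text{ for all }\beta\in \mathrm{H}^1(G,\mathbb{F}_p)\}.$$ For an open subgroup $U\le G$, corestriction maps $\mathcal{R}_p(U)$ into $\mathcal{R}_p(G)$, inducing $c_{U,G}:\mathcal{R}_p(U)\to\mathcal{R}_p(G)$. $G$ has the $p$-Kijima--Nishi property if $c_{U,G}$ is surjective for every open normal subgroup $U$ of index $p$. -}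

module Defs where

open import Level using (Level; _⊔_; Lift; lift; lower; 0ℓ) renaming (suc to lsuc)
open import Algebra.Bundles using (Group; CommutativeRing)
open import Algebra.Structures using (IsGroup; IsCommutativeRing)
open import Algebra.Morphism.Structures using (module GroupMorphisms)
import Algebra.Properties.Group as GroupProperties
import Algebra.Properties.CommutativeMonoid.Sum as CommutativeMonoidSum
import Algebra.Properties.Semiring.Sum as SemiringSum
open import Data.Fin.Base as Fin using (Fin)
import Data.Fin.Properties as Fin
open import Data.Fin.Permutation using (Permutation; permutation)
open import Data.Integer.Base as ℤ using (ℤ; +_)
import Data.Integer.Properties as ℤ
open import Data.Integer.Divisibility.Signed using (_∣_; divides)
import Data.Integer.Tactic.RingSolver as ℤSolver
open import Data.List.Relation.Unary.Any using (Any)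
open import Data.Nat.Base as ℕ using (ℕ; _^_)
open import Data.Product.Base using (Σ; Σ-syntax; ∃-syntax; _×_; _,_; proj₁; proj₂; uncurry)
open import Data.Product.Relation.Binary.Pointwise.NonDependent using (×-setoid)
open import Data.Sum.Base using (_⊎_; inj₁; inj₂)
open import Data.Unit.Polymorphic using (tt)
open import Function.Base using (_∘_; id)
open import Function.Bundles using (Func; Inverse)
open import Function.Definitions using (StrictlySurjective)
open import Relation.Binary.Bundles using (Setoid)
open import Relation.Binary.Definitions using (_Respects_)
open import Relation.Binary.PropositionalEquality as ≡ using (_≡_)
open import Relation.Nullary using (¬_; yes; no; decidable-stable)
open import Relation.Unary using (Pred; _∈_; _⊆_; _≐_; _∩_; _∪_; ⋃; _⊢_; Empty; Satisfiable)
open import Relation.Unary.Polymorphic using (U)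
import Relation.Binary.Reasoning.Setoid as SetoidReasoning

private
  variable
    ℓ o o′ : Level

-- Subsets of a setoid are predicates; open ones must respect its equality.
record Topology (S : Setoid ℓ ℓ) (o : Level) : Set (lsuc ℓ ⊔ lsuc o) where
  open Setoid S
  field
    IsOpen      : Pred Carrier ℓ → Set o
    open-resp-≈ : ∀ {V} → IsOpen V → V Respects _≈_
    open-resp-≐ : ∀ {V W} → V ≐ W → IsOpen V → IsOpen W
    open-U      : IsOpen U
    open-∩      : ∀ {V W} → IsOpen V → IsOpen W → IsOpen (V ∩ W)
    open-⋃      : {I : Set ℓ} (F : I → Pred Carrier ℓ) →
                  (∀ i → IsOpen (F i)) → IsOpen (⋃ I F)

module _ {S : Setoid ℓ ℓ} (T : Topology S o) where
  open Setoid S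
  open Topology T

  Continuous : {S′ : Setoid ℓ ℓ} → Topology S′ o′ →
               (Carrier → Setoid.Carrier S′) → Set (lsuc ℓ ⊔ o ⊔ o′)
  Continuous T′ f = ∀ {W} → Topology.IsOpen T′ W → IsOpen (f ⊢ W)

  -- Continuity of a map into a discrete space: its fibres are open.
  ContinuousToDiscrete : (D : Setoid 0ℓ 0ℓ) → (Carrier → Setoid.Carrier D) → Set o
  ContinuousToDiscrete D f = ∀ d → IsOpen (λ x → Lift ℓ (Setoid._≈_ D (f x) d))

  Compact : Set (lsuc ℓ ⊔ o)
  Compact = {I : Set ℓ} (F : I → Pred Carrier ℓ) → (∀ i → IsOpen (F i)) →
            (∀ x → ∃[ i ] x ∈ F i) →
            ∃[ is ] (∀ x → Any (λ i → x ∈ F i) is)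

  Separated : Carrier → Carrier → Set (lsuc ℓ ⊔ o)
  Separated x y = ∃[ V ] ∃[ W ] (IsOpen V × IsOpen W × x ∈ V × y ∈ W × Empty (V ∩ W))

  -- Points with no disjoint open neighbourhoods are equal.
  Hausdorff : Set (lsuc ℓ ⊔ o)
  Hausdorff = ∀ {x y} → ¬ Separated x y → x ≈ y

  Connected : Pred Carrier ℓ → Set (lsuc ℓ ⊔ o)
  Connected C = ∀ {V W} → IsOpen V → IsOpen W → C ⊆ V ∪ W →
                Satisfiable (C ∩ V) → Satisfiable (C ∩ W) → ¬ Empty (C ∩ (V ∩ W))

  TotallyDisconnected : Set (lsuc ℓ ⊔ o)
  TotallyDisconnected = ∀ {C} → Connected C → ∀ {x y} → x ∈ C → y ∈ C → x ≈ y

module _ {S S′ : Setoid ℓ ℓ} (T : Topology S o) (T′ : Topology S′ o′) where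
  private
    module S  = Setoid S
    module S′ = Setoid S′
    module T  = Topology T
    module T′ = Topology T′

  infixr 2 _×ᵗ_

  _×ᵗ_ : Topology (×-setoid S S′) (lsuc ℓ ⊔ o ⊔ o′)
  _×ᵗ_ = record
    { IsOpen      = λ W → ∀ {x y} → (x , y) ∈ W →
                    ∃[ A ] ∃[ B ] (T.IsOpen A × T′.IsOpen B × x ∈ A × y ∈ B ×
                      (∀ {a b} → a ∈ A → b ∈ B → (a , b) ∈ W))
    ; open-resp-≈ = λ oW (x≈ , y≈) w →
        let A , B , oA , oB , a , b , sub = oW w
        in sub (T.open-resp-≈ oA x≈ a) (T′.open-resp-≈ oB y≈ b)
    ; open-resp-≐ = λ (f , g) oV w →
        let A , B , oA , oB , a , b , sub = oV (g w)
        in A , B , oA , oB , a , b , λ a b → f (sub a b)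
    ; open-U      = λ _ → U , U , T.open-U , T′.open-U , tt , tt , λ _ _ → tt
    ; open-∩      = λ oV oW (v , w) →
        let A , B , oA , oB , a , b , sub = oV v
            C , D , oC , oD , c , d , sub′ = oW w
        in A ∩ C , B ∩ D , T.open-∩ oA oC , T′.open-∩ oB oD , (a , c) , (b , d) ,
           λ (a , c) (b , d) → sub a b , sub′ c d
    ; open-⋃      = λ F oF (i , w) →
        let A , B , oA , oB , a , b , sub = oF i w
        in A , B , oA , oB , a , b , λ a b → i , sub a b
    }

  proj₁-continuous : Continuous _×ᵗ_ T proj₁
  proj₁-continuous {W} oW w = W , U , oW , T′.open-U , w , tt , λ a _ → a

  proj₂-continuous : Continuous _×ᵗ_ T′ proj₂
  proj₂-continuous {W} oW w = U , W , T.open-U , oW , tt , w , λ _ b → b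

module _ {S : Setoid ℓ ℓ} (T : Topology S o) where
  open Topology T

  continuousToDiscrete-∘ : ∀ {S′ : Setoid ℓ ℓ} {T′ : Topology S′ o′} {D f g} →
    Continuous T T′ f → ContinuousToDiscrete T′ D g → ContinuousToDiscrete T D (g ∘ f)
  continuousToDiscrete-∘ cf cg d = cf (cg d)

  continuousToDiscrete-op₁ : ∀ {D E : Setoid 0ℓ 0ℓ} {f}
    (h : Func D E) → ContinuousToDiscrete T D f →
    ContinuousToDiscrete T E (Func.to h ∘ f)
  continuousToDiscrete-op₁ {D} {E} {f} h cf e = open-resp-≐
    ( (λ (lift (a , ha≈e) , lift fx≈a) → lift (E.trans (Func.cong h fx≈a) ha≈e))
    , λ {x} (lift eq) → lift (f x , eq) , lift D.refl )
    (open-⋃ {I = Lift ℓ (∃[ a ] Func.to h a E.≈ e)} _ (λ i → cf (proj₁ (lower i))))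
    where
    module D = Setoid D
    module E = Setoid E

  continuousToDiscrete-op₂ : ∀ {D : Setoid 0ℓ 0ℓ} (let open Setoid D) {f g}
    (_∗_ : Carrier → Carrier → Carrier) →
    (∀ {a b c d} → a ≈ b → c ≈ d → (a ∗ c) ≈ (b ∗ d)) →
    ContinuousToDiscrete T D f → ContinuousToDiscrete T D g →
    ContinuousToDiscrete T D (λ x → f x ∗ g x)
  continuousToDiscrete-op₂ {D} {f} {g} _∗_ ∗-cong cf cg d = open-resp-≐
    ( (λ (lift (_ , _ , ab≈d) , lift fx≈a , lift gx≈b) →
         lift (D.trans (∗-cong fx≈a gx≈b) ab≈d))
    , λ {x} (lift eq) → lift (f x , g x , eq) , lift D.refl , lift D.refl )
    (open-⋃ {I = Lift ℓ (∃[ a ] ∃[ b ] (a ∗ b) D.≈ d)} _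
      (λ i → let a , b , _ = lower i in open-∩ (cf a) (cg b)))
    where module D = Setoid D

  continuousToDiscrete-const : ∀ {D : Setoid 0ℓ 0ℓ} (let open Setoid D) c →
    ContinuousToDiscrete T D (λ _ → c)
  continuousToDiscrete-const {D} c d = open-resp-≐ (proj₁ , (λ eq → eq , tt))
    (open-⋃ {I = Lift ℓ (Setoid._≈_ D c d)} _ (λ _ → open-U))

record TopologicalGroup (ℓ : Level) : Set (lsuc ℓ) where
  field
    group : Group ℓ ℓ
  open Group group public hiding (_-_)
  field
    topology : Topology setoid ℓ
  open Topology topology public
  field
    ∙-continuous  : Continuous (topology ×ᵗ topology) topology (uncurry _∙_)
    ⁻¹-continuous : Continuous topology topology _⁻¹

  open GroupProperties group public

  ∙-continuousʳ : ∀ g → Continuous topology topology (g ∙_)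
  ∙-continuousʳ g {W} oW = open-resp-≐
    ( (λ ((h , ghW) , m) →
         let A , B , _ , _ , a , _ , sub = ∙-continuous oW ghW in sub a m)
    , λ {h} ghW → (h , ghW) , (let _ , _ , _ , _ , _ , b , _ = ∙-continuous oW ghW in b) )
    (open-⋃ {I = Σ Carrier (λ h → g ∙ h ∈ W)}
      (λ (h , ghW) → proj₁ (proj₂ (∙-continuous oW ghW)))
      (λ (h , ghW) → let _ , _ , _ , oB , _ = ∙-continuous oW ghW in oB))

  ∙-continuousˡ : ∀ g → Continuous topology topology (_∙ g)
  ∙-continuousˡ g {W} oW = open-resp-≐
    ( (λ ((h , hgW) , m) →
         let A , B , _ , _ , _ , b , sub = ∙-continuous oW hgW in sub m b)
    , λ {h} hgW → (h , hgW) , (let _ , _ , _ , _ , a , _ = ∙-continuous oW hgW in a) )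
    (open-⋃ {I = Σ Carrier (λ h → h ∙ g ∈ W)}
      (λ (h , hgW) → proj₁ (∙-continuous oW hgW))
      (λ (h , hgW) → let _ , _ , oA , _ = ∙-continuous oW hgW in oA))

record ProfiniteGroup (ℓ : Level) : Set (lsuc ℓ) where
  field
    topologicalGroup : TopologicalGroup ℓ
  open TopologicalGroup topologicalGroup public
  field
    compact             : Compact topology
    hausdorff           : Hausdorff topology
    totallyDisconnected : TotallyDisconnected topology

record OpenSubgroup (G : TopologicalGroup ℓ) : Set (lsuc ℓ) where
  open TopologicalGroup G
  field
    Member    : Pred Carrier ℓ
    isOpen    : IsOpen Member
    ε-closed  : ε ∈ Member
    ∙-closed  : ∀ {g h} → g ∈ Member → h ∈ Member → g ∙ h ∈ Member
    ⁻¹-closed : ∀ {g} → g ∈ Member → g ⁻¹ ∈ Member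

  resp : Member Respects _≈_
  resp = open-resp-≈ isOpen

  Normal : Set ℓ
  Normal = ∀ g {u} → u ∈ Member → g ∙ u ∙ g ⁻¹ ∈ Member

  rightCosets : Setoid ℓ ℓ
  rightCosets = record
    { Carrier       = Carrier
    ; _≈_           = λ g h → g ∙ h ⁻¹ ∈ Member
    ; isEquivalence = record
      { refl  = λ {g} → resp (sym (inverseʳ g)) ε-closed
      ; sym   = λ {g} {h} m → resp (⁻¹-anti-homo-// g h) (⁻¹-closed m)
      ; trans = λ {g} {h} {k} m n → resp (cancel g h k) (∙-closed m n)
      }
    }
    where
    cancel : ∀ g h k → (g ∙ h ⁻¹) ∙ (h ∙ k ⁻¹) ≈ g ∙ k ⁻¹
    cancel g h k = trans (assoc g _ _) (∙-congˡ (\\-leftDividesʳ h (k ⁻¹)))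

  HasIndex : ℕ → Set ℓ
  HasIndex n = Inverse rightCosets (≡.setoid (Fin n))

  subgroup : Group ℓ ℓ
  subgroup = record
    { Carrier = Σ Carrier Member
    ; _≈_     = λ u v → proj₁ u ≈ proj₁ v
    ; _∙_     = λ u v → proj₁ u ∙ proj₁ v , ∙-closed (proj₂ u) (proj₂ v)
    ; ε       = ε , ε-closed
    ; _⁻¹     = λ u → proj₁ u ⁻¹ , ⁻¹-closed (proj₂ u)
    ; isGroup = record
      { isMonoid = record
        { isSemigroup = record
          { isMagma = record
            { isEquivalence = record { refl = refl ; sym = sym ; trans = trans }
            ; ∙-cong        = ∙-cong
            }
          ; assoc = λ u v w → assoc (proj₁ u) (proj₁ v) (proj₁ w)
          }
        ; identity = (λ u → identityˡ (proj₁ u)) , (λ u → identityʳ (proj₁ u))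
        }
      ; inverse = (λ u → inverseˡ (proj₁ u)) , (λ u → inverseʳ (proj₁ u))
      ; ⁻¹-cong = ⁻¹-cong
      }
    }

  private module H = Group subgroup

  image : Pred H.Carrier ℓ → Pred Carrier ℓ
  image W g = Σ[ m ∈ g ∈ Member ] (g , m) ∈ W

  -- The subspace topology: as the subgroup is open, its relatively open
  -- subsets are those that are open in the whole group.
  subspace : Topology H.setoid ℓ
  subspace = record
    { IsOpen      = λ W → (W Respects H._≈_) × IsOpen (image W)
    ; open-resp-≈ = proj₁
    ; open-resp-≐ = λ (f , g) (r , oV) →
        (λ e w → f (r e (g w))) ,
        open-resp-≐ ((λ (m , v) → m , f v) , (λ (m , w) → m , g w)) oV
    ; open-U      = (λ _ _ → tt) , open-resp-≐ ((λ m → m , tt) , proj₁) isOpen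
    ; open-∩      = λ {V} {W} (r , oV) (s , oW) →
        (λ e (v , w) → r e v , s e w) ,
        open-resp-≐
          ( (λ ((m , v) , (m′ , w)) → m , v , s refl w)
          , (λ (m , v , w) → (m , v) , (m , w)) )
          (open-∩ oV oW)
    ; open-⋃      = λ F oF →
        (λ e (i , w) → i , proj₁ (oF i) e w) ,
        open-resp-≐
          ( (λ (i , m , w) → m , i , w) , (λ (m , i , w) → i , m , w) )
          (open-⋃ _ (λ i → proj₂ (oF i)))
    }

  restrict : ∀ {W} → IsOpen W → Topology.IsOpen subspace (λ u → proj₁ u ∈ W)
  restrict oW = open-resp-≈ oW , open-resp-≐ (id , id) (open-∩′ isOpen oW)
    where
    open-∩′ : ∀ {V W} → IsOpen V → IsOpen W → IsOpen (λ g → Σ[ _ ∈ V g ] W g)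
    open-∩′ oV oW = open-resp-≐ (id , id) (open-∩ oV oW)

  topologicalSubgroup : TopologicalGroup ℓ
  topologicalSubgroup = record
    { group         = subgroup
    ; topology      = subspace
    ; ∙-continuous  = λ {W} (r , oW) {u} {v} w →
        let A , B , oA , oB , a , b , sub = ∙-continuous oW (∙-closed (proj₂ u) (proj₂ v) , w)
        in (λ x → proj₁ x ∈ A) , (λ x → proj₁ x ∈ B) , restrict oA , restrict oB , a , b ,
           λ a b → r refl (proj₂ (sub a b))
    ; ⁻¹-continuous = λ {W} (r , oW) →
        (λ e w → r (⁻¹-cong e) w) ,
        open-resp-≐
          ( (λ (m , m′ , w) → m , r refl w)
          , (λ (m , w) → m , ⁻¹-closed m , w) )
          (open-∩ isOpen (⁻¹-continuous oW))
    }

module _ (p : ℕ) where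

  record Congruent (a b : ℤ) : Set where
    constructor congruent
    field divisible : + p ∣ a ℤ.- b

module _ {p : ℕ} where

  private
    infix 4 _≈_
    _≈_ = Congruent p

    reflexive : ∀ {a b} → a ≡ b → a ≈ b
    reflexive {a} ≡.refl = congruent (divides (+ 0) (ℤ.+-inverseʳ a))

    neg : ∀ q n → ℤ.- (q ℤ.* n) ≡ ℤ.- q ℤ.* n
    neg = ℤSolver.solve-∀

    swap-minus : ∀ a b → b ℤ.- a ≡ ℤ.- (a ℤ.- b)
    swap-minus = ℤSolver.solve-∀

    split-minus : ∀ a b c → a ℤ.- c ≡ (a ℤ.- b) ℤ.+ (b ℤ.- c)
    split-minus = ℤSolver.solve-∀

    add-minus : ∀ a b c d → (a ℤ.+ c) ℤ.- (b ℤ.+ d) ≡ (a ℤ.- b) ℤ.+ (c ℤ.- d)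
    add-minus = ℤSolver.solve-∀

    mul-minus : ∀ a b c d → (a ℤ.* c) ℤ.- (b ℤ.* d) ≡ (a ℤ.- b) ℤ.* c ℤ.+ (c ℤ.- d) ℤ.* b
    mul-minus = ℤSolver.solve-∀

    neg-minus : ∀ a b → ℤ.- a ℤ.- (ℤ.- b) ≡ ℤ.- (a ℤ.- b)
    neg-minus = ℤSolver.solve-∀

    collect : ∀ q r n c b → (q ℤ.* n) ℤ.* c ℤ.+ (r ℤ.* n) ℤ.* b ≡ (q ℤ.* c ℤ.+ r ℤ.* b) ℤ.* n
    collect = ℤSolver.solve-∀

    ≈-sym : ∀ {a b} → a ≈ b → b ≈ a
    ≈-sym {a} {b} (congruent (divides q e)) = congruent (divides (ℤ.- q)
      (≡.trans (swap-minus a b) (≡.trans (≡.cong ℤ.-_ e) (neg q (+ p)))))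

    ≈-trans : ∀ {a b c} → a ≈ b → b ≈ c → a ≈ c
    ≈-trans {a} {b} {c} (congruent (divides q e)) (congruent (divides r f)) =
      congruent (divides (q ℤ.+ r)
        (≡.trans (split-minus a b c)
          (≡.trans (≡.cong₂ ℤ._+_ e f) (≡.sym (ℤ.*-distribʳ-+ (+ p) q r)))))

    +-cong : ∀ {a b c d} → a ≈ b → c ≈ d → a ℤ.+ c ≈ b ℤ.+ d
    +-cong {a} {b} {c} {d} (congruent (divides q e)) (congruent (divides r f)) =
      congruent (divides (q ℤ.+ r)
        (≡.trans (add-minus a b c d)
          (≡.trans (≡.cong₂ ℤ._+_ e f) (≡.sym (ℤ.*-distribʳ-+ (+ p) q r)))))

    *-cong : ∀ {a b c d} → a ≈ b → c ≈ d → a ℤ.* c ≈ b ℤ.* d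
    *-cong {a} {b} {c} {d} (congruent (divides q e)) (congruent (divides r f)) =
      congruent (divides (q ℤ.* c ℤ.+ r ℤ.* b)
        (≡.trans (mul-minus a b c d)
          (≡.trans (≡.cong₂ (λ x y → x ℤ.* c ℤ.+ y ℤ.* b) e f) (collect q r (+ p) c b))))

    -‿cong : ∀ {a b} → a ≈ b → ℤ.- a ≈ ℤ.- b
    -‿cong {a} {b} (congruent (divides q e)) = congruent (divides (ℤ.- q)
      (≡.trans (neg-minus a b) (≡.trans (≡.cong ℤ.-_ e) (neg q (+ p)))))

  ℤ/-isCommutativeRing : IsCommutativeRing (Congruent p) ℤ._+_ ℤ._*_ ℤ.-_ (+ 0) (+ 1)
  ℤ/-isCommutativeRing = record
    { isRing = record
      { +-isAbelianGroup = record
        { isGroup = record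
          { isMonoid = record
            { isSemigroup = record
              { isMagma = record
                { isEquivalence = record
                  { refl = reflexive ≡.refl ; sym = ≈-sym ; trans = ≈-trans }
                ; ∙-cong        = +-cong
                }
              ; assoc = λ a b c → reflexive (ℤ.+-assoc a b c)
              }
            ; identity = (reflexive ∘ ℤ.+-identityˡ) , (reflexive ∘ ℤ.+-identityʳ)
            }
          ; inverse = (reflexive ∘ ℤ.+-inverseˡ) , (reflexive ∘ ℤ.+-inverseʳ)
          ; ⁻¹-cong = -‿cong
          }
        ; comm = λ a b → reflexive (ℤ.+-comm a b)
        }
      ; *-cong     = *-cong
      ; *-assoc    = λ a b c → reflexive (ℤ.*-assoc a b c)
      ; *-identity = (reflexive ∘ ℤ.*-identityˡ) , (reflexive ∘ ℤ.*-identityʳ)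
      ; distrib    = (λ a b c → reflexive (ℤ.*-distribˡ-+ a b c)) ,
                     (λ a b c → reflexive (ℤ.*-distribʳ-+ a b c))
      }
    ; *-comm = λ a b → reflexive (ℤ.*-comm a b)
    }

ℤ/ : ℕ → CommutativeRing 0ℓ 0ℓ
ℤ/ p = record { isCommutativeRing = ℤ/-isCommutativeRing {p} }

module Identities (p : ℕ) where
  open import Data.Integer.Base using (_+_; _*_; _-_; -_; 0ℤ)
  open CommutativeRing (ℤ/ p) using (_≈_; reflexive)

  δ-add : ∀ x y z x′ y′ z′ → (x - y + z) + (x′ - y′ + z′) ≈ (x + x′) - (y + y′) + (z + z′)
  δ-add x y z x′ y′ z′ = reflexive (eq x y z x′ y′ z′)
    where
    eq : ∀ x y z x′ y′ z′ → (x - y + z) + (x′ - y′ + z′) ≡ (x + x′) - (y + y′) + (z + z′)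
    eq = ℤSolver.solve-∀

  δ-neg : ∀ x y z → - (x - y + z) ≈ (- x) - (- y) + (- z)
  δ-neg x y z = reflexive (eq x y z)
    where
    eq : ∀ x y z → - (x - y + z) ≡ (- x) - (- y) + (- z)
    eq = ℤSolver.solve-∀

  δ-zero : 0ℤ ≈ 0ℤ - 0ℤ + 0ℤ
  δ-zero = reflexive ≡.refl

  telescope : ∀ x y z → x - z ≈ (x - y) + (y - z)
  telescope x y z = reflexive (eq x y z)
    where
    eq : ∀ x y z → x - z ≡ (x - y) + (y - z)
    eq = ℤSolver.solve-∀

  flip-minus : ∀ x y → y - x ≈ - (x - y)
  flip-minus x y = reflexive (eq x y)
    where
    eq : ∀ x y → y - x ≡ - (x - y)
    eq = ℤSolver.solve-∀

  cancel-plus : ∀ a b → (b - (a + b)) + a ≈ 0ℤ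
  cancel-plus a b = reflexive (eq a b)
    where
    eq : ∀ a b → (b - (a + b)) + a ≡ 0ℤ
    eq = ℤSolver.solve-∀

  from-cocycle : ∀ a b c → c ≈ (a + b) - (b - c + a)
  from-cocycle a b c = reflexive (eq a b c)
    where
    eq : ∀ a b c → c ≡ (a + b) - (b - c + a)
    eq = ℤSolver.solve-∀

  sub-zero : ∀ a → a - 0ℤ ≈ a
  sub-zero a = reflexive (eq a)
    where
    eq : ∀ a → a - 0ℤ ≡ a
    eq = ℤSolver.solve-∀

  cup-identity : ∀ a b d f → b * f - (a + b) * f + a * (d + f) - a * d ≈ 0ℤ
  cup-identity a b d f = reflexive (eq a b d f)
    where
    eq : ∀ a b d f → b * f - (a + b) * f + a * (d + f) - a * d ≡ 0ℤ
    eq = ℤSolver.solve-∀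

  zero-identity : 0ℤ - 0ℤ + 0ℤ - 0ℤ ≈ 0ℤ
  zero-identity = reflexive ≡.refl

  δ-from-sum : ∀ s x y z → z + x ≈ s + y → s ≈ z - y + x
  δ-from-sum s x y z e = begin
    s              ≈⟨ reflexive (eq₁ s y) ⟩
    (s + y) - y    ≈⟨ A.+-congʳ (A.sym e) ⟩
    (z + x) - y    ≈⟨ reflexive (eq₂ x y z) ⟩
    z - y + x      ∎
    where
    module A = CommutativeRing (ℤ/ p)
    open SetoidReasoning A.setoid
    eq₁ : ∀ s y → s ≡ (s + y) - y
    eq₁ = ℤSolver.solve-∀
    eq₂ : ∀ x y z → (z + x) - y ≡ z - y + x
    eq₂ = ℤSolver.solve-∀

  projection-identity : ∀ fv fw av aw b′ b″ x →
    (fw - aw * b″) + (fv - av * b′) ≈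
    av * x + (((fv + fw) - (av * ((b′ + x) - b″) - 0ℤ)) - (av + aw) * b″)
  projection-identity fv fw av aw b′ b″ x = reflexive (eq fv fw av aw b′ b″ x)
    where
    eq : ∀ fv fw av aw b′ b″ x →
      (fw - aw * b″) + (fv - av * b′) ≡
      av * x + (((fv + fw) - (av * ((b′ + x) - b″) - 0ℤ)) - (av + aw) * b″)
    eq = ℤSolver.solve-∀

-- Continuous cohomology in degrees 1 and 2, by inhomogeneous cochains,
-- with coefficients in the discrete trivial module ℤ/p
module Cohomology (p : ℕ) where

  private
    module A = CommutativeRing (ℤ/ p)
    open module Identitiesₚ = Identities p
  open A using (_+_; _*_; -_; _-_; 0#) renaming (_≈_ to _≈ᴬ_)

  record C¹ (G : TopologicalGroup ℓ) : Set ℓ where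
    open TopologicalGroup G
    field
      ⟦_⟧        : Carrier → A.Carrier
      cong       : ∀ {g h} → g ≈ h → ⟦_⟧ g ≈ᴬ ⟦_⟧ h
      continuous : ContinuousToDiscrete topology A.setoid ⟦_⟧

  record C² (G : TopologicalGroup ℓ) : Set (lsuc ℓ) where
    open TopologicalGroup G
    field
      ⟦_⟧        : Carrier → Carrier → A.Carrier
      cong       : ∀ {g g′ h h′} → g ≈ g′ → h ≈ h′ → ⟦_⟧ g h ≈ᴬ ⟦_⟧ g′ h′
      continuous : ContinuousToDiscrete (topology ×ᵗ topology) A.setoid (uncurry ⟦_⟧)

  module _ (G : TopologicalGroup ℓ) where
    open TopologicalGroup G

    δ¹ : (Carrier → A.Carrier) → Carrier → Carrier → A.Carrier
    δ¹ f g h = f h - f (g ∙ h) + f g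

    δ² : (Carrier → Carrier → A.Carrier) → Carrier → Carrier → Carrier → A.Carrier
    δ² c g h k = c h k - c (g ∙ h) k + c g (h ∙ k) - c g h

  record Z¹ (G : TopologicalGroup ℓ) : Set ℓ where
    field
      cochain : C¹ G
    open C¹ cochain public
    field
      isCocycle : ∀ g h → δ¹ G ⟦_⟧ g h ≈ᴬ 0#

  record Z² (G : TopologicalGroup ℓ) : Set (lsuc ℓ) where
    field
      cochain : C² G
    open C² cochain public
    field
      isCocycle : ∀ g h k → δ² G ⟦_⟧ g h k ≈ᴬ 0#

  -- The action is trivial, so every 1-coboundary is zero.
  H¹ : TopologicalGroup ℓ → Setoid ℓ ℓ
  H¹ G = record
    { Carrier       = Z¹ G
    ; _≈_           = λ α β → ∀ g → Z¹.⟦_⟧ α g ≈ᴬ Z¹.⟦_⟧ β g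
    ; isEquivalence = record
      { refl  = λ _ → A.refl
      ; sym   = λ e g → A.sym (e g)
      ; trans = λ e f g → A.trans (e g) (f g)
      }
    }

  module _ {G : TopologicalGroup ℓ} where
    open TopologicalGroup G

    infixl 6 _+ᶜ_

    _+ᶜ_ : C¹ G → C¹ G → C¹ G
    a +ᶜ b = record
      { ⟦_⟧        = λ g → C¹.⟦_⟧ a g + C¹.⟦_⟧ b g
      ; cong       = λ e → A.+-cong (C¹.cong a e) (C¹.cong b e)
      ; continuous = continuousToDiscrete-op₂ topology {D = A.setoid} _+_ A.+-cong
                       (C¹.continuous a) (C¹.continuous b)
      }

    -ᶜ_ : C¹ G → C¹ G
    -ᶜ a = record
      { ⟦_⟧        = λ g → - C¹.⟦_⟧ a g
      ; cong       = λ e → A.-‿cong (C¹.cong a e)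
      ; continuous = continuousToDiscrete-op₁ topology {D = A.setoid} {E = A.setoid}
                       (record { to = -_ ; cong = A.-‿cong }) (C¹.continuous a)
      }

    0ᶜ : C¹ G
    0ᶜ = record
      { ⟦_⟧        = λ _ → 0#
      ; cong       = λ _ → A.refl
      ; continuous = continuousToDiscrete-const topology {D = A.setoid} 0#
      }

    Z¹-homo : (α : Z¹ G) → ∀ g h → Z¹.⟦_⟧ α (g ∙ h) ≈ᴬ Z¹.⟦_⟧ α g + Z¹.⟦_⟧ α h
    Z¹-homo α g h = begin
      α.⟦ g ∙ h ⟧                                 ≈⟨ from-cocycle α.⟦ g ⟧ α.⟦ h ⟧ α.⟦ g ∙ h ⟧ ⟩
      (α.⟦ g ⟧ + α.⟦ h ⟧) - δ¹ G α.⟦_⟧ g h        ≈⟨ A.+-congˡ {x = α.⟦ g ⟧ + α.⟦ h ⟧} (A.-‿cong (α.isCocycle g h)) ⟩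
      (α.⟦ g ⟧ + α.⟦ h ⟧) - 0#                    ≈⟨ sub-zero (α.⟦ g ⟧ + α.⟦ h ⟧) ⟩
      α.⟦ g ⟧ + α.⟦ h ⟧                           ∎
      where
      module α = Z¹ α
      open SetoidReasoning A.setoid

  H² : TopologicalGroup ℓ → Setoid (lsuc ℓ) ℓ
  H² G = record
    { Carrier       = Z² G
    ; _≈_           = λ c c′ → Σ[ f ∈ C¹ G ] ∀ g h →
                        Z².⟦_⟧ c g h - Z².⟦_⟧ c′ g h ≈ᴬ δ¹ G (C¹.⟦_⟧ f) g h
    ; isEquivalence = record
      { refl  = λ {c} → 0ᶜ , λ g h → A.trans (A.-‿inverseʳ (Z².⟦_⟧ c g h)) δ-zero
      ; sym   = λ {c} {c′} (f , e) → -ᶜ f , λ g h →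
          A.trans (flip-minus (Z².⟦_⟧ c g h) (Z².⟦_⟧ c′ g h))
            (A.trans (A.-‿cong (e g h))
              (δ-neg (C¹.⟦_⟧ f h) (C¹.⟦_⟧ f (g ∙ h)) (C¹.⟦_⟧ f g)))
      ; trans = λ {c} {c′} {c″} (f , e) (f′ , e′) → f +ᶜ f′ , λ g h →
          A.trans (telescope (Z².⟦_⟧ c g h) (Z².⟦_⟧ c′ g h) (Z².⟦_⟧ c″ g h))
            (A.trans (A.+-cong (e g h) (e′ g h))
              (δ-add (C¹.⟦_⟧ f h) (C¹.⟦_⟧ f (g ∙ h)) (C¹.⟦_⟧ f g)
                     (C¹.⟦_⟧ f′ h) (C¹.⟦_⟧ f′ (g ∙ h)) (C¹.⟦_⟧ f′ g)))
      }
    }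
    where open TopologicalGroup G using (_∙_)

  module _ {G : TopologicalGroup ℓ} where
    open TopologicalGroup G

    0² : Z² G
    0² = record
      { cochain   = record
        { ⟦_⟧        = λ _ _ → 0#
        ; cong       = λ _ _ → A.refl
        ; continuous = continuousToDiscrete-const (topology ×ᵗ topology) {D = A.setoid} 0#
        }
      ; isCocycle = λ _ _ _ → zero-identity
      }

    infixl 7 _⌣_

    _⌣_ : Z¹ G → Z¹ G → Z² G
    α ⌣ β = record
      { cochain   = record
        { ⟦_⟧        = λ g h → α.⟦ g ⟧ * β.⟦ h ⟧
        ; cong       = λ e f → A.*-cong (α.cong e) (β.cong f)
        ; continuous = continuousToDiscrete-op₂ (topology ×ᵗ topology) {D = A.setoid} _*_ A.*-cong
            (continuousToDiscrete-∘ (topology ×ᵗ topology) {T′ = topology} {D = A.setoid}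
              (proj₁-continuous topology topology) α.continuous)
            (continuousToDiscrete-∘ (topology ×ᵗ topology) {T′ = topology} {D = A.setoid}
              (proj₂-continuous topology topology) β.continuous)
        }
      ; isCocycle = λ g h k → A.trans
          (A.+-congʳ {x = - (α.⟦ g ⟧ * β.⟦ h ⟧)} (A.+-cong
            (A.+-congˡ {x = α.⟦ h ⟧ * β.⟦ k ⟧} (A.-‿cong (A.*-congʳ {x = β.⟦ k ⟧} (Z¹-homo α g h))))
            (A.*-congˡ {x = α.⟦ g ⟧} (Z¹-homo β h k))))
          (cup-identity α.⟦ g ⟧ α.⟦ h ⟧ β.⟦ h ⟧ β.⟦ k ⟧)
      }
      where
      module α = Z¹ α
      module β = Z¹ β

  R : TopologicalGroup ℓ → Setoid ℓ ℓ
  R G = record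
    { Carrier       = Σ[ α ∈ Z¹ G ] ∀ β → Setoid._≈_ (H² G) (α ⌣ β) 0²
    ; _≈_           = λ α β → Setoid._≈_ (H¹ G) (proj₁ α) (proj₁ β)
    ; isEquivalence = record
      { refl  = λ {α} → H.refl {proj₁ α}
      ; sym   = λ {α} {β} → H.sym {proj₁ α} {proj₁ β}
      ; trans = λ {α} {β} {γ} → H.trans {proj₁ α} {proj₁ β} {proj₁ γ}
      }
    }
    where module H = Setoid (H¹ G)

  module _ {G : TopologicalGroup ℓ} (H : OpenSubgroup G) where
    open TopologicalGroup G
    private module H = OpenSubgroup H

    res : Z¹ G → Z¹ H.topologicalSubgroup
    res β = record
      { cochain   = record
        { ⟦_⟧        = λ u → β.⟦ proj₁ u ⟧
        ; cong       = β.cong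
        ; continuous = λ d → H.restrict (β.continuous d)
        }
      ; isCocycle = λ u v → β.isCocycle (proj₁ u) (proj₁ v)
      }
      where module β = Z¹ β

  module Corestriction {G : TopologicalGroup ℓ} (H : OpenSubgroup G)
                       {n : ℕ} (index : OpenSubgroup.HasIndex H n) where
    open TopologicalGroup G
    open OpenSubgroup H
    module S = TopologicalGroup topologicalSubgroup
    private
      open Inverse index using (to; from; to-cong; strictlyInverseˡ; strictlyInverseʳ)
      open CommutativeMonoidSum A.+-commutativeMonoid
        using (sum; sum-cong-≋; ∑-distrib-+; sum-permute)
      open SemiringSum A.semiring using (*-distribʳ-sum)

    -- The right cosets are represented by the elements from i; the coset of
    -- from i multiplied by g on the right is that of from (next i g).
    next : Fin n → Carrier → Fin n
    next i g = to (from i ∙ g)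

    factor : Fin n → Carrier → S.Carrier
    factor i g = from i ∙ g ∙ from (next i g) ⁻¹ ,
                 Setoid.sym rightCosets (strictlyInverseʳ (from i ∙ g))

    ≈⇒coset : ∀ {g h} → g ≈ h → g ∙ h ⁻¹ ∈ Member
    ≈⇒coset e = resp (sym (x≈y⇒x∙y⁻¹≈ε e)) ε-closed

    next-cong : ∀ i {g h} → g ≈ h → next i g ≡ next i h
    next-cong i e = to-cong (≈⇒coset (∙-congˡ e))

    next-unique : ∀ i j {g} → from i ∙ g ∙ from j ⁻¹ ∈ Member → next i g ≡ j
    next-unique i j m = ≡.trans (to-cong m) (strictlyInverseˡ j)

    combine : ∀ a b c g h → (a ∙ g ∙ b ⁻¹) ∙ (b ∙ h ∙ c ⁻¹) ≈ a ∙ (g ∙ h) ∙ c ⁻¹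
    combine a b c g h = begin
      (a ∙ g ∙ b ⁻¹) ∙ (b ∙ h ∙ c ⁻¹)   ≈⟨ assoc _ _ _ ⟩
      a ∙ g ∙ (b ⁻¹ ∙ (b ∙ h ∙ c ⁻¹))   ≈⟨ ∙-congˡ (∙-congˡ (assoc b h _)) ⟩
      a ∙ g ∙ (b ⁻¹ ∙ (b ∙ (h ∙ c ⁻¹))) ≈⟨ ∙-congˡ (\\-leftDividesʳ b _) ⟩
      a ∙ g ∙ (h ∙ c ⁻¹)                ≈⟨ assoc _ _ _ ⟨
      a ∙ g ∙ h ∙ c ⁻¹                  ≈⟨ ∙-congʳ (assoc a g h) ⟩
      a ∙ (g ∙ h) ∙ c ⁻¹                ∎
      where open SetoidReasoning setoid

    next-∙ : ∀ i g h → next i (g ∙ h) ≡ next (next i g) h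
    next-∙ i g h = next-unique i _
      (resp (combine _ _ _ g h)
        (∙-closed (proj₂ (factor i g)) (proj₂ (factor (next i g) h))))

    next-ε : ∀ i → next i ε ≡ i
    next-ε i = ≡.trans (to-cong (≈⇒coset (identityʳ (from i)))) (strictlyInverseˡ i)

    factor-cong : ∀ i {g h} → g ≈ h → factor i g S.≈ factor i h
    factor-cong i e =
      ∙-cong (∙-congˡ e) (⁻¹-cong (reflexive (≡.cong from (next-cong i e))))

    factor-∙ : ∀ i g h → factor i (g ∙ h) S.≈ factor i g S.∙ factor (next i g) h
    factor-∙ i g h = trans
      (∙-congˡ (⁻¹-cong (reflexive (≡.cong from (next-∙ i g h)))))
      (sym (combine _ _ _ g h))

    next-permutation : Carrier → Permutation n n
    next-permutation g = permutation (λ i → next i g) (λ i → next i (g ⁻¹))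
      (λ i → ≡.trans (≡.sym (next-∙ i (g ⁻¹) g))
               (≡.trans (next-cong i (inverseˡ g)) (next-ε i)))
      (λ i → ≡.trans (≡.sym (next-∙ i g (g ⁻¹)))
               (≡.trans (next-cong i (inverseʳ g)) (next-ε i)))

    translate : ∀ i j {W} → IsOpen W → IsOpen (λ g → from i ∙ g ∙ from j ⁻¹ ∈ W)
    translate i j oW = ∙-continuousʳ (from i) (∙-continuousˡ (from j ⁻¹) oW)

    next-continuous : ∀ i (γ : Fin n → A.Carrier) →
      ContinuousToDiscrete topology A.setoid (λ g → γ (next i g))
    next-continuous i γ d = open-resp-≐
      ( (λ {g} ((lift (j , e)) , m) →
           lift (A.trans (A.reflexive (≡.cong γ (next-unique i j m))) e))
      , λ {g} (lift e) → lift (next i g , e) , proj₂ (factor i g) )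
      (open-⋃ {I = Lift ℓ (∃[ j ] γ j ≈ᴬ d)} _
        (λ k → translate i (proj₁ (lower k)) isOpen))

    factor-continuous : ∀ i (f : C¹ topologicalSubgroup) →
      ContinuousToDiscrete topology A.setoid (λ g → C¹.⟦_⟧ f (factor i g))
    factor-continuous i f d = open-resp-≐
      ( (λ {g} (lift j , m , lift e) →
           lift (A.trans
             (C¹.cong f {g = factor i g} {h = from i ∙ g ∙ from j ⁻¹ , m}
               (∙-congˡ (⁻¹-cong (reflexive (≡.cong from (next-unique i j m))))))
             e))
      , λ {g} (lift e) → lift (next i g) , proj₂ (factor i g) , lift e )
      (open-⋃ {I = Lift ℓ (Fin n)} _
        (λ j → translate i (lower j) (proj₂ (C¹.continuous f d))))

    sum-continuous : ∀ {m} (f : Fin m → Carrier → A.Carrier) →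
      (∀ i → ContinuousToDiscrete topology A.setoid (f i)) →
      ContinuousToDiscrete topology A.setoid (λ g → sum (λ i → f i g))
    sum-continuous {ℕ.zero}  f cf = continuousToDiscrete-const topology {D = A.setoid} 0#
    sum-continuous {ℕ.suc m} f cf =
      continuousToDiscrete-op₂ topology {D = A.setoid} _+_ A.+-cong
        (cf Fin.zero) (sum-continuous (f ∘ Fin.suc) (cf ∘ Fin.suc))

    sum-next : ∀ (f : Fin n → A.Carrier) g → sum f ≈ᴬ sum (λ i → f (next i g))
    sum-next f g = sum-permute f (next-permutation g)

    module _ (α : Z¹ topologicalSubgroup) where
      private
        module α = Z¹ α

      -- On homogeneous cochains corestriction is
      -- (cor x)(g₀ , g₁) = Σ_c c̄⁻¹ x(c̄ g₀ (c̄g₀)‾⁻¹ , c̄ g₁ (c̄g₁)‾⁻¹), summed over the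
      -- right cosets c with representatives c̄; at (ε , g), with trivial action
      -- and α(u₀⁻¹ u₁) for x(u₀ , u₁), it becomes Σ_c α(c̄ g (c̄g)‾⁻¹).
      corCochain : C¹ G
      corCochain = record
        { ⟦_⟧        = λ g → sum (λ i → α.⟦ factor i g ⟧)
        ; cong       = λ {g} {h} e → sum-cong-≋ {x = λ i → α.⟦ factor i g ⟧}
                         (λ i → α.cong {g = factor i g} {h = factor i h} (factor-cong i e))
        ; continuous = sum-continuous (λ i g → α.⟦ factor i g ⟧)
                         (λ i → factor-continuous i α.cochain)
        }

      private
        module cor = C¹ corCochain

        factor-homo : ∀ i g h →
          α.⟦ factor i (g ∙ h) ⟧ ≈ᴬ α.⟦ factor i g ⟧ + α.⟦ factor (next i g) h ⟧
        factor-homo i g h = A.trans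
          (α.cong {g = factor i (g ∙ h)} {h = factor i g S.∙ factor (next i g) h}
            (factor-∙ i g h))
          (Z¹-homo α (factor i g) (factor (next i g) h))

        cor-homo : ∀ g h → cor.⟦ g ∙ h ⟧ ≈ᴬ cor.⟦ g ⟧ + cor.⟦ h ⟧
        cor-homo g h = begin
          sum (λ i → α.⟦ factor i (g ∙ h) ⟧)
            ≈⟨ sum-cong-≋ (λ i → factor-homo i g h) ⟩
          sum (λ i → α.⟦ factor i g ⟧ + α.⟦ factor (next i g) h ⟧)
            ≈⟨ ∑-distrib-+ (λ i → α.⟦ factor i g ⟧) (λ i → α.⟦ factor (next i g) h ⟧) ⟩
          cor.⟦ g ⟧ + sum (λ i → α.⟦ factor (next i g) h ⟧)
            ≈⟨ A.+-congˡ {x = cor.⟦ g ⟧} (sum-next (λ i → α.⟦ factor i h ⟧) g) ⟨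
          cor.⟦ g ⟧ + cor.⟦ h ⟧ ∎
          where open SetoidReasoning A.setoid

      cor : Z¹ G
      cor = record
        { cochain   = corCochain
        ; isCocycle = λ g h → A.trans
            (A.+-congʳ {x = cor.⟦ g ⟧} (A.+-congˡ {x = cor.⟦ h ⟧} (A.-‿cong (cor-homo g h))))
            (cancel-plus cor.⟦ g ⟧ cor.⟦ h ⟧)
        }

      -- The projection formula, for a product α ⌣ res β that vanishes: if f has
      -- coboundary α ⌣ res β, then F has coboundary cor α ⌣ β.
      cor-⌣ : ∀ β → Setoid._≈_ (H² topologicalSubgroup) (α ⌣ res H β) 0² →
              Setoid._≈_ (H² G) (cor ⌣ β) 0²
      cor-⌣ β (f , δf) = F , λ g h → A.trans (sub-zero (cor.⟦ g ⟧ * β.⟦ h ⟧))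
        (δ-from-sum (cor.⟦ g ⟧ * β.⟦ h ⟧) F.⟦ g ⟧ F.⟦ g ∙ h ⟧ F.⟦ h ⟧ (total g h))
        where
        module β = Z¹ β
        module f = C¹ f

        b : Fin n → A.Carrier
        b j = β.⟦ from j ⟧

        term : Fin n → Carrier → A.Carrier
        term i g = f.⟦ factor i g ⟧ - α.⟦ factor i g ⟧ * b (next i g)

        F : C¹ G
        F = record
          { ⟦_⟧        = λ g → sum (λ i → term i g)
          ; cong       = λ {g} {h} e → sum-cong-≋ {x = λ i → term i g} (λ i → A.+-cong
              (f.cong {g = factor i g} {h = factor i h} (factor-cong i e))
              (A.-‿cong (A.*-cong
                (α.cong {g = factor i g} {h = factor i h} (factor-cong i e))
                (A.reflexive (≡.cong b (next-cong i e))))))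
          ; continuous = sum-continuous term (λ i →
              continuousToDiscrete-op₂ topology {D = A.setoid} _-_
                (λ e e′ → A.+-cong e (A.-‿cong e′))
                (factor-continuous i f)
                (continuousToDiscrete-op₂ topology {D = A.setoid} _*_ A.*-cong
                  (factor-continuous i α.cochain) (next-continuous i b)))
          }
        module F = C¹ F

        open SetoidReasoning A.setoid

        β-factor : ∀ j h → β.⟦ proj₁ (factor j h) ⟧ ≈ᴬ (b j + β.⟦ h ⟧) - b (next j h)
        β-factor j h = begin
          y                     ≈⟨ GroupProperties.//-rightDividesʳ A.+-group b″ y ⟨
          (y + b″) - b″         ≈⟨ A.+-congʳ {x = - b″} (Z¹-homo β w (from (next j h))) ⟨
          β.⟦ w ∙ from (next j h) ⟧ - b″
            ≈⟨ A.+-congʳ {x = - b″} (β.cong (//-rightDividesˡ (from (next j h)) (from j ∙ h))) ⟩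
          β.⟦ from j ∙ h ⟧ - b″ ≈⟨ A.+-congʳ {x = - b″} (Z¹-homo β (from j) h) ⟩
          (b j + β.⟦ h ⟧) - b″  ∎
          where
          w  = proj₁ (factor j h)
          y  = β.⟦ w ⟧
          b″ = b (next j h)

        pointwise : ∀ g h i →
          term (next i g) h + term i g ≈ᴬ α.⟦ factor i g ⟧ * β.⟦ h ⟧ + term i (g ∙ h)
        pointwise g h i = begin
          term (next i g) h + term i g
            ≈⟨ projection-identity f.⟦ v ⟧ f.⟦ w ⟧ α.⟦ v ⟧ α.⟦ w ⟧ (b j) (b k) β.⟦ h ⟧ ⟩
          αβ + (((f.⟦ v ⟧ + f.⟦ w ⟧) - (α.⟦ v ⟧ * ((b j + β.⟦ h ⟧) - b k) - 0#))
                 - (α.⟦ v ⟧ + α.⟦ w ⟧) * b k)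
            ≈⟨ A.+-congˡ {x = αβ} (A.+-cong f-part (A.-‿cong (A.*-cong
                 (factor-homo i g h) (A.reflexive (≡.cong b (next-∙ i g h)))))) ⟨
          αβ + term i (g ∙ h) ∎
          where
          j = next i g
          k = next j h
          v = factor i g
          w = factor j h
          αβ = α.⟦ v ⟧ * β.⟦ h ⟧

          f-part : f.⟦ factor i (g ∙ h) ⟧ ≈ᴬ
                   (f.⟦ v ⟧ + f.⟦ w ⟧) - (α.⟦ v ⟧ * ((b j + β.⟦ h ⟧) - b k) - 0#)
          f-part = begin
            f.⟦ factor i (g ∙ h) ⟧
              ≈⟨ f.cong {g = factor i (g ∙ h)} {h = v S.∙ w} (factor-∙ i g h) ⟩
            f.⟦ v S.∙ w ⟧
              ≈⟨ from-cocycle f.⟦ v ⟧ f.⟦ w ⟧ f.⟦ v S.∙ w ⟧ ⟩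
            (f.⟦ v ⟧ + f.⟦ w ⟧) - δ¹ topologicalSubgroup f.⟦_⟧ v w
              ≈⟨ A.+-congˡ {x = f.⟦ v ⟧ + f.⟦ w ⟧} (A.-‿cong (δf v w)) ⟨
            (f.⟦ v ⟧ + f.⟦ w ⟧) - (α.⟦ v ⟧ * β.⟦ proj₁ w ⟧ - 0#)
              ≈⟨ A.+-congˡ {x = f.⟦ v ⟧ + f.⟦ w ⟧} (A.-‿cong (A.+-congʳ {x = - 0#}
                   (A.*-congˡ {x = α.⟦ v ⟧} (β-factor j h)))) ⟩
            (f.⟦ v ⟧ + f.⟦ w ⟧) - (α.⟦ v ⟧ * ((b j + β.⟦ h ⟧) - b k) - 0#) ∎

        total : ∀ g h → F.⟦ h ⟧ + F.⟦ g ⟧ ≈ᴬ cor.⟦ g ⟧ * β.⟦ h ⟧ + F.⟦ g ∙ h ⟧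
        total g h = begin
          F.⟦ h ⟧ + F.⟦ g ⟧
            ≈⟨ A.+-congʳ {x = F.⟦ g ⟧} (sum-next (λ i → term i h) g) ⟩
          sum (λ i → term (next i g) h) + F.⟦ g ⟧
            ≈⟨ ∑-distrib-+ (λ i → term (next i g) h) (λ i → term i g) ⟨
          sum (λ i → term (next i g) h + term i g)
            ≈⟨ sum-cong-≋ (pointwise g h) ⟩
          sum (λ i → α.⟦ factor i g ⟧ * β.⟦ h ⟧ + term i (g ∙ h))
            ≈⟨ ∑-distrib-+ (λ i → α.⟦ factor i g ⟧ * β.⟦ h ⟧) (λ i → term i (g ∙ h)) ⟩
          sum (λ i → α.⟦ factor i g ⟧ * β.⟦ h ⟧) + F.⟦ g ∙ h ⟧
            ≈⟨ A.+-congʳ {x = F.⟦ g ∙ h ⟧} (*-distribʳ-sum β.⟦ h ⟧ (λ i → α.⟦ factor i g ⟧)) ⟨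
          cor.⟦ g ⟧ * β.⟦ h ⟧ + F.⟦ g ∙ h ⟧ ∎

    cor-cong : ∀ {α β} → Setoid._≈_ (H¹ topologicalSubgroup) α β →
               Setoid._≈_ (H¹ G) (cor α) (cor β)
    cor-cong {α} e g = sum-cong-≋ {x = λ i → Z¹.⟦_⟧ α (factor i g)} (λ i → e (factor i g))

    corᴿ : Func (R topologicalSubgroup) (R G)
    corᴿ = record
      { to   = λ (α , r) → cor α , λ β → cor-⌣ α β (r (res H β))
      ; cong = λ {α} {β} → cor-cong {proj₁ α} {proj₁ β}
      }

-- An index is an explicit numbering of the cosets; the corestriction class does
-- not depend on it.
KijimaNishi : ℕ → ProfiniteGroup ℓ → Set (lsuc ℓ)
KijimaNishi p 𝓖 =
  (H : OpenSubgroup G) → OpenSubgroup.Normal H → (index : OpenSubgroup.HasIndex H p) →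
  StrictlySurjective (Setoid._≈_ (R G)) (Func.to (Corestriction.corᴿ H index))
  where
  G = ProfiniteGroup.topologicalGroup 𝓖
  open Cohomology p

record FinitePGroup (p : ℕ) : Set where
  field
    exponent : ℕ
  Carrier : Set
  Carrier = Fin (p ^ exponent)
  field
    _∙_     : Carrier → Carrier → Carrier
    ε       : Carrier
    _⁻¹     : Carrier → Carrier
    isGroup : IsGroup _≡_ _∙_ ε _⁻¹

  group : Group 0ℓ 0ℓ
  group = record { isGroup = isGroup }

record ContinuousHom (G : TopologicalGroup ℓ) (P : Group 0ℓ 0ℓ) : Set ℓ where
  open TopologicalGroup G using (rawGroup; topology)
  module P = Group P
  field
    ⟦_⟧        : TopologicalGroup.Carrier G → P.Carrier
    isHom      : GroupMorphisms.IsGroupHomomorphism rawGroup P.rawGroup ⟦_⟧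
    continuous : ContinuousToDiscrete topology P.setoid ⟦_⟧
  open GroupMorphisms.IsGroupHomomorphism isHom public

-- The open normal subgroups with quotient a finite p-group are exactly the
-- kernels of continuous homomorphisms to finite p-groups, and every finite
-- p-group has a copy with underlying set Fin (p ^ k).  So the quotient by the
-- intersection of all such subgroups has the same elements as G, identified
-- when no such homomorphism tells them apart; its opens in the quotient
-- topology are the open subsets of G that respect this identification.
module MaximalProP (p : ℕ) (G : ProfiniteGroup ℓ) where
  private module G = ProfiniteGroup G

  Hom : FinitePGroup p → Set ℓ
  Hom P = ContinuousHom G.topologicalGroup (FinitePGroup.group P)

  infix 4 _≈_
  _≈_ : G.Carrier → G.Carrier → Set ℓ
  x ≈ y = ∀ P (φ : Hom P) → ContinuousHom.⟦_⟧ φ x ≡ ContinuousHom.⟦_⟧ φ y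

  ≈ᴳ⇒≈ : ∀ {x y} → x G.≈ y → x ≈ y
  ≈ᴳ⇒≈ e P φ = ContinuousHom.⟦⟧-cong φ e

  quotientGroup : Group ℓ ℓ
  quotientGroup = record
    { Carrier = G.Carrier
    ; _≈_     = _≈_
    ; _∙_     = G._∙_
    ; ε       = G.ε
    ; _⁻¹     = G._⁻¹
    ; isGroup = record
      { isMonoid = record
        { isSemigroup = record
          { isMagma = record
            { isEquivalence = record
              { refl  = λ _ _ → ≡.refl
              ; sym   = λ e P φ → ≡.sym (e P φ)
              ; trans = λ e f P φ → ≡.trans (e P φ) (f P φ)
              }
            ; ∙-cong = λ {x} {y} {u} {v} e f P φ →
                let open ContinuousHom φ in
                ≡.trans (homo x u)
                  (≡.trans (≡.cong₂ (FinitePGroup._∙_ P) (e P φ) (f P φ)) (≡.sym (homo y v)))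
            }
          ; assoc = λ x y z → ≈ᴳ⇒≈ (G.assoc x y z)
          }
        ; identity = (λ x → ≈ᴳ⇒≈ (G.identityˡ x)) , (λ x → ≈ᴳ⇒≈ (G.identityʳ x))
        }
      ; inverse = (λ x → ≈ᴳ⇒≈ (G.inverseˡ x)) , (λ x → ≈ᴳ⇒≈ (G.inverseʳ x))
      ; ⁻¹-cong = λ {x} {y} e P φ →
          let open ContinuousHom φ in
          ≡.trans (⁻¹-homo x)
            (≡.trans (≡.cong (FinitePGroup._⁻¹ P) (e P φ)) (≡.sym (⁻¹-homo y)))
      }
    }

  private module Q = Group quotientGroup

  quotientTopology : Topology Q.setoid ℓ
  quotientTopology = record
    { IsOpen      = λ W → (W Respects _≈_) × G.IsOpen W
    ; open-resp-≈ = proj₁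
    ; open-resp-≐ = λ (f , g) (r , oV) → (λ e w → f (r e (g w))) , G.open-resp-≐ (f , g) oV
    ; open-U      = (λ _ _ → tt) , G.open-U
    ; open-∩      = λ (r , oV) (s , oW) → (λ e (v , w) → r e v , s e w) , G.open-∩ oV oW
    ; open-⋃      = λ F oF → (λ e (i , w) → i , proj₁ (oF i) e w) ,
                             G.open-⋃ F (λ i → proj₂ (oF i))
    }

  open Topology quotientTopology

  saturate : Pred G.Carrier ℓ → Pred G.Carrier ℓ
  saturate A x = ∃[ a ] (a ∈ A × x ≈ a)

  saturate-open : ∀ {A} → G.IsOpen A → IsOpen (saturate A)
  saturate-open {A} oA =
    (λ e (a , m , f) → a , m , Q.trans (Q.sym e) f) ,
    G.open-resp-≐
      ( (λ {x} ((k , k≈ε) , m) → x G.∙ k , m ,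
           Q.trans (Q.sym (Q.identityʳ x)) (Q.∙-congˡ (Q.sym k≈ε)))
      , (λ {x} (a , m , e) →
           (x G.⁻¹ G.∙ a , Q.trans (Q.∙-congˡ (Q.sym e)) (Q.inverseˡ x)) ,
           G.open-resp-≈ oA (G.sym (G.\\-leftDividesˡ x a)) m) )
      (G.open-⋃ {I = Σ G.Carrier (λ k → k ≈ G.ε)} (λ (k , _) x → x G.∙ k ∈ A)
        (λ (k , _) → G.∙-continuousˡ k oA))

  fibre-open : ∀ P (φ : Hom P) c → IsOpen (λ x → Lift ℓ (ContinuousHom.⟦_⟧ φ x ≡ c))
  fibre-open P φ c = (λ e (lift f) → lift (≡.trans (≡.sym (e P φ)) f)) ,
                   ContinuousHom.continuous φ c

  cofibre-open : ∀ P (φ : Hom P) c → IsOpen (λ x → Lift ℓ (¬ ContinuousHom.⟦_⟧ φ x ≡ c))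
  cofibre-open P φ c = open-resp-≐
    ( (λ (lift (d , d≢c) , lift e) → lift (λ f → d≢c (≡.trans (≡.sym e) f)))
    , (λ (lift ne) → lift (ContinuousHom.⟦_⟧ φ _ , ne) , lift ≡.refl) )
    (open-⋃ {I = Lift ℓ (∃[ d ] ¬ d ≡ c)} _ (λ i → fibre-open P φ (proj₁ (lower i))))

  maximalProPQuotient : ProfiniteGroup ℓ
  maximalProPQuotient = record
    { topologicalGroup = record
      { group         = quotientGroup
      ; topology      = quotientTopology
      ; ∙-continuous  = λ (r , oW) w →
          let A , B , oA , oB , a , b , sub = G.∙-continuous oW w
          in saturate A , saturate B , saturate-open oA , saturate-open oB ,
             (_ , a , Q.refl) , (_ , b , Q.refl) ,
             λ (_ , a′ , e) (_ , b′ , f) → r (Q.sym (Q.∙-cong e f)) (sub a′ b′)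
      ; ⁻¹-continuous = λ (r , oW) → (λ e → r (Q.⁻¹-cong e)) , G.⁻¹-continuous oW
      }
    ; compact             = λ F oF → G.compact F (λ i → proj₂ (oF i))
    ; hausdorff           = λ {x} {y} ¬sep P φ → let open ContinuousHom φ in
        decidable-stable (⟦ x ⟧ Fin.≟ ⟦ y ⟧) λ ne →
        ¬sep (_ , _ , fibre-open P φ ⟦ x ⟧ , fibre-open P φ ⟦ y ⟧ , lift ≡.refl , lift ≡.refl ,
              λ _ (lift e , lift f) → ne (≡.trans (≡.sym e) f))
    ; totallyDisconnected = λ conn {x} {y} cx cy P φ → let open ContinuousHom φ in
        decidable-stable (⟦ x ⟧ Fin.≟ ⟦ y ⟧) λ ne →
        conn (fibre-open P φ ⟦ y ⟧) (cofibre-open P φ ⟦ y ⟧)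
          (λ {z} _ → cover P φ z)
          (y , cy , lift ≡.refl) (x , cx , lift ne)
          (λ _ (_ , lift e , lift e≢) → e≢ e)
    }
    where
    cover : ∀ P (φ : Hom P) z {c} →
            Lift ℓ (ContinuousHom.⟦_⟧ φ z ≡ c) ⊎ Lift ℓ (¬ ContinuousHom.⟦_⟧ φ z ≡ c)
    cover P φ z {c} with ContinuousHom.⟦_⟧ φ z Fin.≟ c
    ... | yes e = inj₁ (lift e)
    ... | no ne = inj₂ (lift ne)

open MaximalProP public using (maximalProPQuotient)

{-# OPTIONS --safe #-}
module Submission where

open import Defs
open import Level using (Level; Lift; lift; lower; 0ℓ) renaming (suc to lsuc)
open import Algebra.Bundles using (Group; CommutativeRing)
open import Algebra.Core using (Op₁; Op₂)
open import Algebra.Structures using (IsGroup)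
import Algebra.Properties.CommutativeMonoid.Sum as CommutativeMonoidSum
import Algebra.Properties.Group as GroupProperties
open import Data.Fin.Base as Fin using (Fin; toℕ; fromℕ<; finToFun; funToFin)
import Data.Fin.Properties as Fin
open import Data.Integer.Base as ℤ using (ℤ; +_; 0ℤ)
import Data.Integer.DivMod as ℤ
import Data.Integer.Properties as ℤ
open import Data.Integer.Divisibility.Signed using (divides; ∣⇒∣ᵤ)
import Data.Integer.Tactic.RingSolver as ℤSolver
open import Data.Nat.Base as ℕ using (ℕ; zero; suc; NonZero; _^_)
import Data.Nat.Divisibility as ℕ
import Data.Nat.Properties as ℕ
open import Data.Nat.Primality using (Prime; prime⇒nonZero)
open import Data.Product.Base using (_×_; Σ; ∃-syntax; _,_; proj₁; proj₂)
open import Data.Product.Function.NonDependent.Setoid using (_×-inverse_)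
open import Data.Product.Relation.Binary.Pointwise.NonDependent using (×-setoid; Pointwise-≡↔≡)
open import Data.Unit.Polymorphic using (tt)
open import Data.Vec.Functional.Relation.Binary.Pointwise.Properties
  using () renaming (setoid to pointwise)
open import Function.Base using (id; _∘_)
open import Function.Bundles using (_⇔_; mk⇔; Inverse)
import Function.Construct.Composition as Composition
import Function.Construct.Symmetry as Symmetry
open import Relation.Binary.Bundles using (Setoid)
open import Relation.Binary.Definitions using (_Respects_)
open import Relation.Binary.PropositionalEquality as ≡ using (_≡_; _≗_)
import Relation.Binary.Reasoning.Setoid as SetoidReasoning
open import Relation.Binary.Structures using (IsEquivalence)
open import Relation.Nullary using (contradiction)
open import Relation.Unary using (_∈_)

-- G and G(p) have the same continuous homomorphisms to finite p-groups.  A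
-- class in H¹ is such a homomorphism, and a cochain f with δ¹ f = α ⌣ β is the
-- third coordinate of one to the mod p Heisenberg group, so G and G(p) have the
-- same 𝓡.  An open normal subgroup H of index p is the kernel of a homomorphism
-- to the group G/H of order p, hence comes from G(p).  A homomorphism from H to
-- a finite p-group P induces one from G to the wreath product of P by G/H, so
-- homomorphisms from H also factor through the image of H in G(p), and 𝓡 of H
-- and of its image agree as well.  Corestriction is given by the same formula
-- on both sides.

private
  variable
    a b ℓ o : Level

-- Continuity of maps into finite products of discrete spaces.

module _ {S : Setoid ℓ ℓ} (T : Topology S o) where
  open Topology T

  continuousToDiscrete-× : ∀ {D E : Setoid 0ℓ 0ℓ} {f g} →
    ContinuousToDiscrete T D f → ContinuousToDiscrete T E g →
    ContinuousToDiscrete T (×-setoid D E) (λ x → f x , g x)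
  continuousToDiscrete-× cf cg (d , e) = open-resp-≐
    ( (λ (lift p , lift q) → lift (p , q)) , (λ (lift (p , q)) → lift p , lift q) )
    (open-∩ (cf d) (cg e))

  -- With finitely many coordinates, a fibre is a finite intersection of coordinate fibres, hence
  -- open.
  continuousToDiscrete-pointwise : ∀ n {D : Setoid 0ℓ 0ℓ}
    (f : Fin n → Setoid.Carrier S → Setoid.Carrier D) →
    (∀ i → ContinuousToDiscrete T D (f i)) →
    ContinuousToDiscrete T (pointwise D n) (λ x i → f i x)
  continuousToDiscrete-pointwise zero    f cf d =
    open-resp-≐ ((λ _ → lift λ ()) , (λ _ → tt)) open-U
  continuousToDiscrete-pointwise (suc n) {D} f cf d = open-resp-≐
    ( (λ (lift p , lift q) → lift λ { Fin.zero → p ; (Fin.suc i) → q i })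
    , (λ (lift p) → lift (p Fin.zero) , lift (p ∘ Fin.suc)) )
    (open-∩ (cf Fin.zero (d Fin.zero))
      (continuousToDiscrete-pointwise n {D} (f ∘ Fin.suc) (cf ∘ Fin.suc) (d ∘ Fin.suc)))

-- Numberings of finite setoids.

Numbered : Setoid a b → ℕ → Set _
Numbered S n = Inverse S (≡.setoid (Fin n))

numbered-subst : ∀ {S : Setoid a b} {m n} → m ≡ n → Numbered S m → Numbered S n
numbered-subst {S = S} = ≡.subst (Numbered S)

-- The group laws of a FinitePGroup carry their own proof that _≡_ is an equivalence.
numbered-≡ : ∀ {n} (≡-isEquivalence : IsEquivalence {A = Fin n} _≡_) →
  Numbered (record { isEquivalence = ≡-isEquivalence }) n
numbered-≡ _ = record
  { to = id ; from = id ; to-cong = id ; from-cong = id ; inverse = id , id }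

numbered-× : ∀ {S : Setoid a b} {T : Setoid a b} {m n} →
  Numbered S m → Numbered T n → Numbered (×-setoid S T) (m ℕ.* n)
numbered-× i j = Composition.inverse (Composition.inverse (i ×-inverse j) Pointwise-≡↔≡)
  (Symmetry.inverse Fin.*↔×)

funToFin-cong : ∀ {m n} {f g : Fin m → Fin n} → f ≗ g → funToFin f ≡ funToFin g
funToFin-cong {zero}  e = ≡.refl
funToFin-cong {suc m} e = ≡.cong₂ Fin.combine (e Fin.zero) (funToFin-cong (e ∘ Fin.suc))

numbered-pointwise : ∀ {S : Setoid a b} m {n} → Numbered S n → Numbered (pointwise S m) (n ^ m)
numbered-pointwise {S = S} m i = record
  { to        = λ f → funToFin (I.to ∘ f)
  ; from      = λ k → I.from ∘ finToFun k
  ; to-cong   = λ e → funToFin-cong (I.to-cong ∘ e)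
  ; from-cong = λ { ≡.refl _ → Setoid.refl S }
  ; inverse   =
      (λ {k} e → ≡.trans
        (funToFin-cong (λ j → I.inverseˡ (e j)))
        (Fin.funToFin-finToFin {m} k))
    , (λ { {f} ≡.refl j → I.inverseʳ (Fin.finToFun-funToFin (I.to ∘ f) j) })
  }
  where module I = Inverse i

-- Finite p-groups and homomorphisms to them.

transport : ∀ {n} (P : Group a b) → Numbered (Group.setoid P) n → Group 0ℓ 0ℓ
transport {n = n} P i = record
  { Carrier = Fin n
  ; _≈_     = _≡_
  ; _∙_     = λ x y → to (from x P.∙ from y)
  ; ε       = to P.ε
  ; _⁻¹     = λ x → to (from x P.⁻¹)
  ; isGroup = record
    { isMonoid = record
      { isSemigroup = record
        { isMagma = record { isEquivalence = ≡.isEquivalence ; ∙-cong = ≡.cong₂ _ }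
        ; assoc = λ x y z → to-cong (P.trans (P.∙-congʳ (strictlyInverseʳ _))
            (P.trans (P.assoc _ _ _) (P.∙-congˡ (P.sym (strictlyInverseʳ _)))))
        }
      ; identity =
          (λ x → ≡.trans (to-cong (P.trans (P.∙-congʳ (strictlyInverseʳ _)) (P.identityˡ _)))
                   (strictlyInverseˡ x))
        , (λ x → ≡.trans (to-cong (P.trans (P.∙-congˡ (strictlyInverseʳ _)) (P.identityʳ _)))
                   (strictlyInverseˡ x))
      }
    ; inverse =
        (λ x → to-cong (P.trans (P.∙-congʳ (strictlyInverseʳ _)) (P.inverseˡ _)))
      , (λ x → to-cong (P.trans (P.∙-congˡ (strictlyInverseʳ _)) (P.inverseʳ _)))
    ; ⁻¹-cong = ≡.cong (λ x → to (from x P.⁻¹))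
    }
  }
  where
  module P = Group P
  open Inverse i

module _ {T : TopologicalGroup ℓ} {P : Group 0ℓ 0ℓ} where
  private
    module T = TopologicalGroup T
    module P = Group P

  -- Multiplicativity is enough: the image of the unit is idempotent, hence the unit, and inverses
  -- follow.
  continuousHom : (f : T.Carrier → P.Carrier) → (∀ {x y} → x T.≈ y → f x P.≈ f y) →
    (∀ x y → f (x T.∙ y) P.≈ f x P.∙ f y) →
    ContinuousToDiscrete T.topology P.setoid f → ContinuousHom T P
  continuousHom f f-cong f-homo f-cont = record
    { ⟦_⟧        = f
    ; isHom      = record
      { isMonoidHomomorphism = record
        { isMagmaHomomorphism = record
          { isRelHomomorphism = record { cong = f-cong }
          ; homo = f-homo
          }
        ; ε-homo = f-ε
        }
      ; ⁻¹-homo = λ x → Pₚ.inverseˡ-unique _ _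
          (P.trans (P.sym (f-homo _ _)) (P.trans (f-cong (T.inverseˡ x)) f-ε))
      }
    ; continuous = f-cont
    }
    where
    module Pₚ = GroupProperties P
    f-ε : f T.ε P.≈ P.ε
    f-ε = Pₚ.identityʳ-unique _ _ (P.trans (P.sym (f-homo _ _)) (f-cong (T.identityˡ T.ε)))

-- For `T` underlying `G` this is the equality of `maximalProPQuotient`. An arbitrary `T` is allowed
-- because open subgroups are compared in the same way.
Indistinguishable : (p : ℕ) (T : TopologicalGroup ℓ) (x y : TopologicalGroup.Carrier T) → Set ℓ
Indistinguishable p T x y = ∀ (P : FinitePGroup p) (φ : ContinuousHom T (FinitePGroup.group P)) →
  ContinuousHom.⟦_⟧ φ x ≡ ContinuousHom.⟦_⟧ φ y

PPowerSize : ℕ → Setoid a b → Set _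
PPowerSize p S = ∃[ k ] Numbered S (p ^ k)

module _ {p : ℕ} where

  pPowerSize-× : ∀ {S T : Setoid a b} → PPowerSize p S → PPowerSize p T → PPowerSize p (×-setoid S T)
  pPowerSize-× {S = S} {T} (j , m) (k , n) = j ℕ.+ k ,
    numbered-subst {S = ×-setoid S T} (≡.sym (ℕ.^-distribˡ-+-* p j k)) (numbered-× m n)

  pPowerSize-pointwise : ∀ {S : Setoid a b} m → PPowerSize p S → PPowerSize p (pointwise S m)
  pPowerSize-pointwise {S = S} m (k , i) = k ℕ.* m ,
    numbered-subst {S = pointwise S m} (ℕ.^-*-assoc p k m) (numbered-pointwise m i)

  numbered⇒pPowerSize : {S : Setoid a b} → Numbered S p → PPowerSize p S
  numbered⇒pPowerSize {S = S} i = 1 , numbered-subst {S = S} (≡.sym (ℕ.^-identityʳ p)) i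

  finitePGroup : (P : Group a b) → PPowerSize p (Group.setoid P) → FinitePGroup p
  finitePGroup P (k , i) = record
    { exponent = k
    ; isGroup  = Group.isGroup (transport P i)
    }

  -- A `FinitePGroup` lives on `Fin (p ^ k)`, so `φ` is composed with a numbering of `P`. The
  -- numbering is injective, so nothing is lost, and any setoid group of p-power size may serve as a
  -- target.
  indistinguishable⇒≈ : {T : TopologicalGroup ℓ} {P : Group 0ℓ 0ℓ} → PPowerSize p (Group.setoid P) →
    (φ : ContinuousHom T P) → ∀ {x y} → Indistinguishable p T x y →
    Group._≈_ P (ContinuousHom.⟦_⟧ φ x) (ContinuousHom.⟦_⟧ φ y)
  indistinguishable⇒≈ {T = T} {P} size@(_ , i) φ e = begin
    φ.⟦ _ ⟧              ≈⟨ strictlyInverseʳ _ ⟨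
    from (to φ.⟦ _ ⟧)    ≈⟨ from-cong (e (finitePGroup P size) ψ) ⟩
    from (to φ.⟦ _ ⟧)    ≈⟨ strictlyInverseʳ _ ⟩
    φ.⟦ _ ⟧              ∎
    where
    module φ = ContinuousHom φ
    open Inverse i
    open SetoidReasoning (Group.setoid P)
    ψ : ContinuousHom T (FinitePGroup.group (finitePGroup P size))
    ψ = continuousHom (to ∘ φ.⟦_⟧) (to-cong ∘ φ.⟦⟧-cong)
      (λ x y → to-cong (Group.trans P (φ.homo x y) (Group.∙-cong P
        (Group.sym P (strictlyInverseʳ _)) (Group.sym P (strictlyInverseʳ _)))))
      (continuousToDiscrete-op₁ (TopologicalGroup.topology T) {D = Group.setoid P}
        {E = ≡.setoid _} (record { to = to ; cong = to-cong }) φ.continuous)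

-- Residues modulo p.

module _ (p : ℕ) where
  private module A = CommutativeRing (ℤ/ p)

  -- Two numbers below `p` differ by less than `p` in absolute value, and the only multiple of `p`
  -- that small is 0.
  residue-injective : ∀ {i j : Fin p} → + toℕ i A.≈ + toℕ j → i ≡ j
  residue-injective {i} {j} (congruent d) = Fin.toℕ-injective (ℤ.+-injective
    (ℤ.i-j≡0⇒i≡j _ _ (ℤ.∣i∣≡0⇒i≡0 (small (∣⇒∣ᵤ d)))))
    where
    bound : ℤ.∣ + toℕ i ℤ.- + toℕ j ∣ ℕ.< p
    bound = ℕ.≤-<-trans
      (≡.subst (λ z → ℤ.∣ z ∣ ℕ.≤ toℕ i ℕ.⊔ toℕ j) (≡.sym (ℤ.m-n≡m⊖n (toℕ i) (toℕ j)))
        (ℤ.∣m⊝n∣≤m⊔n (toℕ i) (toℕ j)))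
      (ℕ.⊔-lub (Fin.toℕ<n i) (Fin.toℕ<n j))
    small : p ℕ.∣ ℤ.∣ + toℕ i ℤ.- + toℕ j ∣ → ℤ.∣ + toℕ i ℤ.- + toℕ j ∣ ≡ 0
    small p∣n with ℤ.∣ + toℕ i ℤ.- + toℕ j ∣ | bound
    ... | zero  | _   = ≡.refl
    ... | suc n | n<p = contradiction p∣n (ℕ.>⇒∤ n<p)

  residues : .{{NonZero p}} → Numbered A.setoid p
  residues = record
    { to        = λ a → fromℕ< (ℤ.n%ℕd<d a p)
    ; from      = λ i → + toℕ i
    ; to-cong   = λ {a} {b} e → residue-injective
        (A.trans (A.sym (reduce a)) (A.trans e (reduce b)))
    ; from-cong = λ { ≡.refl → A.refl }
    ; inverse   =
        (λ {i} {a} e → residue-injective {_} {i} (A.trans (A.sym (reduce a)) e))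
      , (λ { {a} ≡.refl → A.sym (reduce a) })
    }
    where
    reduce : ∀ a → a A.≈ + toℕ (fromℕ< (ℤ.n%ℕd<d a p))
    reduce a = congruent (divides (a ℤ./ℕ p) (≡.trans
      (≡.cong₂ (λ x y → x ℤ.- + y) (ℤ.a≡a%ℕn+[a/ℕn]*n a p) (Fin.toℕ-fromℕ< (ℤ.n%ℕd<d a p)))
      (cancel (+ (a ℤ.%ℕ p)) (a ℤ./ℕ p ℤ.* + p))))
      where
      cancel : ∀ r q → (r ℤ.+ q) ℤ.- r ≡ q
      cancel = ℤSolver.solve-∀

  -- The Heisenberg group and the invariance of cochains.

  open A using (_+_; _*_; -_; _-_; 0#)

  -- The unitriangular matrices with first row (1 , a , −c) and third column
  -- (−c , b , 1): with this sign the third coordinate of a homomorphism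
  -- (α , β , f) satisfies δ¹ f = α ⌣ β.
  heisenberg : Group 0ℓ 0ℓ
  heisenberg = record
    { Carrier = ℤ × ℤ × ℤ
    ; _≈_     = Setoid._≈_ S
    ; _∙_     = λ (a , b , c) (a′ , b′ , c′) → a + a′ , b + b′ , (c + c′) - a * b′
    ; ε       = 0# , 0# , 0#
    ; _⁻¹     = λ (a , b , c) → - a , - b , - c - a * b
    ; isGroup = record
      { isMonoid = record
        { isSemigroup = record
          { isMagma = record
            { isEquivalence = Setoid.isEquivalence S
            ; ∙-cong = λ (e , f , g) (e′ , f′ , g′) →
                A.+-cong e e′ , A.+-cong f f′ ,
                A.+-cong (A.+-cong g g′) (A.-‿cong (A.*-cong e f′))
            }
          ; assoc = λ (a , b , c) (a′ , b′ , c′) (a″ , b″ , c″) →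
              A.+-assoc a a′ a″ , A.+-assoc b b′ b″ ,
              A.reflexive (assoc a b c a′ b′ c′ a″ b″ c″)
          }
        ; identity =
            (λ (a , b , c) → A.+-identityˡ a , A.+-identityˡ b , A.reflexive (identityˡ b c))
          , (λ (a , b , c) → A.+-identityʳ a , A.+-identityʳ b , A.reflexive (identityʳ a c))
        }
      ; inverse =
          (λ (a , b , c) → A.-‿inverseˡ a , A.-‿inverseˡ b , A.reflexive (inverseˡ a b c))
        , (λ (a , b , c) → A.-‿inverseʳ a , A.-‿inverseʳ b , A.reflexive (inverseʳ a b c))
      ; ⁻¹-cong = λ (e , f , g) → A.-‿cong e , A.-‿cong f ,
          A.+-cong (A.-‿cong g) (A.-‿cong (A.*-cong e f))
      }
    }
    where
    S : Setoid 0ℓ 0ℓ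
    S = ×-setoid A.setoid (×-setoid A.setoid A.setoid)

    assoc : ∀ a b c a′ b′ c′ a″ b″ c″ →
      ((c ℤ.+ c′ ℤ.- a ℤ.* b′) ℤ.+ c″) ℤ.- (a ℤ.+ a′) ℤ.* b″ ≡
      (c ℤ.+ (c′ ℤ.+ c″ ℤ.- a′ ℤ.* b″)) ℤ.- a ℤ.* (b′ ℤ.+ b″)
    assoc = ℤSolver.solve-∀

    identityˡ : ∀ b c → (0ℤ ℤ.+ c) ℤ.- 0ℤ ℤ.* b ≡ c
    identityˡ = ℤSolver.solve-∀

    identityʳ : ∀ a c → (c ℤ.+ 0ℤ) ℤ.- a ℤ.* 0ℤ ≡ c
    identityʳ = ℤSolver.solve-∀

    inverseˡ : ∀ a b c → ((ℤ.- c ℤ.- a ℤ.* b) ℤ.+ c) ℤ.- ℤ.- a ℤ.* b ≡ 0ℤ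
    inverseˡ = ℤSolver.solve-∀

    inverseʳ : ∀ a b c → (c ℤ.+ (ℤ.- c ℤ.- a ℤ.* b)) ℤ.- a ℤ.* (ℤ.- b) ≡ 0ℤ
    inverseʳ = ℤSolver.solve-∀

  open Cohomology p

  module _ .{{_ : NonZero p}} {T : TopologicalGroup ℓ} (α β : Z¹ T) (f : C¹ T)
           (δf : ∀ g h → Z².⟦_⟧ (α ⌣ β) g h - 0# A.≈ δ¹ T (C¹.⟦_⟧ f) g h) where
    private
      module T = TopologicalGroup T
      module α = Z¹ α
      module β = Z¹ β
      module f = C¹ f

    -- The three functions are the coordinates of a single homomorphism to `heisenberg`, which has
    -- p³ elements.
    cup-invariant : ∀ {x y} → Indistinguishable p T x y →
      α.⟦ x ⟧ A.≈ α.⟦ y ⟧ × β.⟦ x ⟧ A.≈ β.⟦ y ⟧ × f.⟦ x ⟧ A.≈ f.⟦ y ⟧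
    cup-invariant = indistinguishable⇒≈ {P = heisenberg}
      (pPowerSize-× size (pPowerSize-× size size)) φ
      where
      size : PPowerSize p A.setoid
      size = numbered⇒pPowerSize residues

      -- Solved for the value at the product, the coboundary equation becomes the multiplication
      -- rule of the third coordinate.
      solve-f : ∀ g h → f.⟦ g T.∙ h ⟧ A.≈ (f.⟦ g ⟧ + f.⟦ h ⟧) - α.⟦ g ⟧ * β.⟦ h ⟧
      solve-f g h = begin
        f.⟦ g T.∙ h ⟧
          ≈⟨ Identities.from-cocycle p f.⟦ g ⟧ f.⟦ h ⟧ f.⟦ g T.∙ h ⟧ ⟩
        (f.⟦ g ⟧ + f.⟦ h ⟧) - δ¹ T f.⟦_⟧ g h
          ≈⟨ A.+-congˡ {x = f.⟦ g ⟧ + f.⟦ h ⟧} (A.-‿cong (δf g h)) ⟨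
        (f.⟦ g ⟧ + f.⟦ h ⟧) - (α.⟦ g ⟧ * β.⟦ h ⟧ - 0#)
          ≈⟨ A.+-congˡ {x = f.⟦ g ⟧ + f.⟦ h ⟧} (A.-‿cong (Identities.sub-zero p (α.⟦ g ⟧ * β.⟦ h ⟧))) ⟩
        (f.⟦ g ⟧ + f.⟦ h ⟧) - α.⟦ g ⟧ * β.⟦ h ⟧ ∎
        where open SetoidReasoning A.setoid

      φ : ContinuousHom T heisenberg
      φ = continuousHom (λ g → α.⟦ g ⟧ , β.⟦ g ⟧ , f.⟦ g ⟧)
        (λ e → α.cong e , β.cong e , f.cong e)
        (λ g h → Z¹-homo α g h , Z¹-homo β g h , solve-f g h)
        (continuousToDiscrete-× T.topology {D = A.setoid} {E = ×-setoid A.setoid A.setoid} α.continuous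
          (continuousToDiscrete-× T.topology {D = A.setoid} {E = A.setoid} β.continuous f.continuous))

  -- The case of `cup-invariant` with zero `β` and zero `f`: the product of `α` with 0 is the
  -- coboundary of 0.
  cocycle-invariant : .{{NonZero p}} → {T : TopologicalGroup ℓ} (α : Z¹ T) →
    ∀ {x y} → Indistinguishable p T x y → Z¹.⟦_⟧ α x A.≈ Z¹.⟦_⟧ α y
  cocycle-invariant α e = proj₁ (cup-invariant α 0¹ 0ᶜ (λ g h → A.reflexive (zero-product (Z¹.⟦_⟧ α g))) e)
    where
    0¹ : Z¹ _
    0¹ = record { cochain = 0ᶜ ; isCocycle = λ _ _ → A.sym (Identities.δ-zero p) }
    zero-product : ∀ a → a ℤ.* 0ℤ ℤ.- 0ℤ ≡ 0ℤ ℤ.- 0ℤ ℤ.+ 0ℤ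
    zero-product = ℤSolver.solve-∀

-- Wreath products.

module _ (P : Group 0ℓ 0ℓ) {n} {_∙_ : Op₂ (Fin n)} {ε : Fin n} {_⁻¹ : Op₁ (Fin n)}
         (C : IsGroup _≡_ _∙_ ε _⁻¹) where
  private
    module P = Group P
    module C = IsGroup C

  -- The equality of the acting group is `_≡_`, so every function on it respects equality. The shift
  -- `i ∙ x` is chosen to match `factor-∙`, where the second factor is taken at the coset
  -- `next i g`.
  wreath : Group 0ℓ 0ℓ
  wreath = record
    { Carrier = (Fin n → P.Carrier) × Fin n
    ; _≈_     = Setoid._≈_ S
    ; _∙_     = λ (f , x) (g , y) → (λ i → f i P.∙ g (i ∙ x)) , x ∙ y
    ; ε       = (λ _ → P.ε) , ε
    ; _⁻¹     = λ (f , x) → (λ i → f (i ∙ (x ⁻¹)) P.⁻¹) , x ⁻¹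
    ; isGroup = record
      { isMonoid = record
        { isSemigroup = record
          { isMagma = record
            { isEquivalence = Setoid.isEquivalence S
            ; ∙-cong = λ { {f , x} {f′ , _} {g , y} {g′ , _} (e , ≡.refl) (e′ , ≡.refl) →
                (λ i → P.∙-cong (e i) (e′ (i ∙ x))) , ≡.refl }
            }
          ; assoc = λ (f , x) (g , y) (h , z) →
              (λ i → P.trans (P.assoc _ _ _)
                 (P.∙-congˡ (P.∙-congˡ (P.reflexive (≡.cong h (≡.sym (C.assoc i x y))))))) ,
              C.assoc x y z
          }
        ; identity =
            (λ (f , x) → (λ i → P.trans (P.identityˡ _) (P.reflexive (≡.cong f (C.identityʳ i)))) ,
                         C.identityˡ x)
          , (λ (f , x) → (λ i → P.identityʳ _) , C.identityʳ x)
        }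
      ; inverse =
          (λ (f , x) → (λ i → P.inverseˡ _) , C.inverseˡ x)
        , (λ (f , x) → (λ i → P.trans
             (P.∙-congˡ (P.⁻¹-cong (P.reflexive (≡.cong f (cancel i x)))))
             (P.inverseʳ _)) , C.inverseʳ x)
      ; ⁻¹-cong = λ { {f , x} (e , ≡.refl) → (λ i → P.⁻¹-cong (e (i ∙ (x ⁻¹)))) , ≡.refl }
      }
    }
    where
    S : Setoid 0ℓ 0ℓ
    S = ×-setoid (pointwise P.setoid n) (≡.setoid (Fin n))
    cancel : ∀ i x → (i ∙ x) ∙ (x ⁻¹) ≡ i
    cancel i x = ≡.trans (C.assoc i x (x ⁻¹)) (≡.trans (≡.cong (i ∙_) (C.inverseʳ x)) (C.identityʳ i))

-- Homomorphisms induced from an open normal subgroup.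

module _ {T : TopologicalGroup ℓ} (H : OpenSubgroup T) where
  open TopologicalGroup T
  open OpenSubgroup H

  ∈-cancel : ∀ {x y} → x ∙ y ⁻¹ ∈ Member → y ∈ Member → x ∈ Member
  ∈-cancel m y∈H = resp (//-rightDividesˡ _ _) (∙-closed m y∈H)

module _ {T : TopologicalGroup ℓ} (H : OpenSubgroup T) (normal : OpenSubgroup.Normal H) where
  open TopologicalGroup T
  open OpenSubgroup H

  quotientBy : Group ℓ ℓ
  quotientBy = record
    { Carrier = Carrier
    ; _≈_     = C._≈_
    ; _∙_     = _∙_
    ; ε       = ε
    ; _⁻¹     = _⁻¹
    ; isGroup = record
      { isMonoid = record
        { isSemigroup = record
          { isMagma = record
            { isEquivalence = C.isEquivalence
            ; ∙-cong = λ {x} {y} {u} {v} e f → resp (mul x y u v) (∙-closed (normal x f) e)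
            }
          ; assoc = λ x y z → ≈⇒~ (assoc x y z)
          }
        ; identity = (λ x → ≈⇒~ (identityˡ x)) , (λ x → ≈⇒~ (identityʳ x))
        }
      ; inverse = (λ x → ≈⇒~ (inverseˡ x)) , (λ x → ≈⇒~ (inverseʳ x))
      ; ⁻¹-cong = λ {x} {y} e → resp (inv x y) (normal (x ⁻¹) (C.sym {x} {y} e))
      }
    }
    where
    module C = Setoid rightCosets
    open SetoidReasoning setoid

    ≈⇒~ : ∀ {x y} → x ≈ y → x C.≈ y
    ≈⇒~ e = resp (sym (x≈y⇒x∙y⁻¹≈ε e)) ε-closed

    mul : ∀ x y u v → (x ∙ (u ∙ v ⁻¹) ∙ x ⁻¹) ∙ (x ∙ y ⁻¹) ≈ (x ∙ u) ∙ (y ∙ v) ⁻¹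
    mul x y u v = begin
      (x ∙ (u ∙ v ⁻¹) ∙ x ⁻¹) ∙ (x ∙ y ⁻¹) ≈⟨ assoc _ _ _ ⟩
      x ∙ (u ∙ v ⁻¹) ∙ (x ⁻¹ ∙ (x ∙ y ⁻¹)) ≈⟨ ∙-congˡ (\\-leftDividesʳ x _) ⟩
      x ∙ (u ∙ v ⁻¹) ∙ y ⁻¹                ≈⟨ ∙-congʳ (assoc x u _) ⟨
      x ∙ u ∙ v ⁻¹ ∙ y ⁻¹                  ≈⟨ assoc _ _ _ ⟩
      x ∙ u ∙ (v ⁻¹ ∙ y ⁻¹)                ≈⟨ ∙-congˡ (⁻¹-anti-homo-∙ y v) ⟨
      (x ∙ u) ∙ (y ∙ v) ⁻¹                 ∎

    inv : ∀ x y → x ⁻¹ ∙ (y ∙ x ⁻¹) ∙ x ⁻¹ ⁻¹ ≈ x ⁻¹ ∙ y ⁻¹ ⁻¹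
    inv x y = begin
      x ⁻¹ ∙ (y ∙ x ⁻¹) ∙ x ⁻¹ ⁻¹   ≈⟨ assoc _ _ _ ⟩
      x ⁻¹ ∙ (y ∙ x ⁻¹ ∙ x ⁻¹ ⁻¹)   ≈⟨ ∙-congˡ (//-rightDividesʳ (x ⁻¹) y) ⟩
      x ⁻¹ ∙ y                      ≈⟨ ∙-congˡ (⁻¹-involutive y) ⟨
      x ⁻¹ ∙ y ⁻¹ ⁻¹                ∎

  module _ {n} (index : HasIndex n) where
    private
      module C = Group quotientBy
      open Inverse index
      -- The coset bookkeeping does not depend on the coefficients.
      open Cohomology.Corestriction 0 H index hiding (module S)
      module S = TopologicalGroup topologicalSubgroup

    cosetGroup : Group 0ℓ 0ℓ
    cosetGroup = transport quotientBy index

    -- The fibre over `j` is the coset of `from j`, a translate of the open subgroup.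
    to-continuous : ContinuousToDiscrete topology (≡.setoid (Fin n)) to
    to-continuous j = open-resp-≐
      ( (λ m → lift (≡.trans (to-cong m) (strictlyInverseˡ j)))
      , (λ {g} (lift e) → ≡.subst (λ k → g ∙ from k ⁻¹ ∈ Member) e
          (C.sym {from (to g)} {g} (strictlyInverseʳ g))) )
      (∙-continuousˡ (from j ⁻¹) isOpen)

    cosetHom : ContinuousHom T cosetGroup
    cosetHom = continuousHom to (λ e → to-cong (≈⇒coset e))
      (λ x y → to-cong (C.∙-cong {x} {from (to x)} {y} {from (to y)}
        (C.sym {from (to x)} {x} (strictlyInverseʳ x)) (C.sym {from (to y)} {y} (strictlyInverseʳ y))))
      to-continuous

    -- By normality, the permutation of the cosets by `g` is right multiplication by the class of
    -- `g`. This turns the coset action into the shift in `wreath`.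
    next≡∙ : ∀ i g → next i g ≡ Group._∙_ cosetGroup i (to g)
    next≡∙ i g = to-cong (C.∙-cong {from i} {from i} {g} {from (to g)} (C.refl {from i})
      (C.sym {from (to g)} {g} (strictlyInverseʳ g)))

    module _ {P : Group 0ℓ 0ℓ} (φ : ContinuousHom topologicalSubgroup P) where
      private
        module P = Group P
        module φ = ContinuousHom φ

      -- The Kaloujnine-Krasner construction, applied to `φ`. It is multiplicative because the
      -- factors satisfy the twisted rule `factor-∙`.
      induced : ContinuousHom T (wreath P (Group.isGroup cosetGroup))
      induced = continuousHom (λ g → (λ i → φ.⟦ factor i g ⟧) , to g)
        (λ e → (λ i → φ.⟦⟧-cong (factor-cong i e)) , to-cong (≈⇒coset e))
        (λ g h →
          (λ i → P.trans (φ.⟦⟧-cong (factor-∙ i g h))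
            (P.trans (φ.homo (factor i g) (factor (next i g) h))
              (P.∙-congˡ (P.reflexive (≡.cong (λ j → φ.⟦ factor j h ⟧) (next≡∙ i g)))))) ,
          ContinuousHom.homo cosetHom g h)
        (continuousToDiscrete-× topology {D = pointwise P.setoid n} {E = ≡.setoid (Fin n)}
          (continuousToDiscrete-pointwise topology n {D = P.setoid}
            (λ i g → φ.⟦ factor i g ⟧) φ-factor-continuous)
          to-continuous)
        where
        φ-factor-continuous : ∀ i → ContinuousToDiscrete topology P.setoid (λ g → φ.⟦ factor i g ⟧)
        φ-factor-continuous i d = open-resp-≐
          ( (λ {g} (lift j , m , lift e) → lift (P.trans
               (φ.⟦⟧-cong {factor i g} {from i ∙ g ∙ from j ⁻¹ , m}
                 (∙-congˡ (⁻¹-cong (reflexive (≡.cong from (next-unique i j m))))))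
               e))
          , (λ {g} (lift e) → lift (next i g) , proj₂ (factor i g) , lift e) )
          (open-⋃ {I = Lift ℓ (Fin n)} _
            (λ j → translate i (lower j) (proj₂ (φ.continuous d))))

      -- In the coordinate of the trivial coset the induced homomorphism is φ up
      -- to conjugation by the chosen representative.
      induced-reflects : ∀ {x y : S.Carrier} →
        (∀ i → φ.⟦ factor i (proj₁ x) ⟧ P.≈ φ.⟦ factor i (proj₁ y) ⟧) → φ.⟦ x ⟧ P.≈ φ.⟦ y ⟧
      induced-reflects {x} {y} e = Pₚ.∙-cancelˡ φ.⟦ r ⟧ _ _ (Pₚ.∙-cancelʳ φ.⟦ r S.⁻¹ ⟧ _ _
        (P.trans (P.sym (conjugate x)) (P.trans (e i₀) (conjugate y))))
        where
        module Pₚ = GroupProperties P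
        i₀ : Fin n
        i₀ = to ε
        r : S.Carrier
        r = from i₀ , ∈-cancel H (strictlyInverseʳ ε) ε-closed
        -- Both `r` and `u` lie in the subgroup, so `u` fixes the trivial coset and its factor there
        -- is `r u r⁻¹`.
        conjugate : ∀ u → φ.⟦ factor i₀ (proj₁ u) ⟧ P.≈ (φ.⟦ r ⟧ P.∙ φ.⟦ u ⟧) P.∙ φ.⟦ r S.⁻¹ ⟧
        conjugate u = P.trans
          (φ.⟦⟧-cong {factor i₀ (proj₁ u)} {r S.∙ u S.∙ r S.⁻¹}
            (∙-congˡ (⁻¹-cong (reflexive (≡.cong from (next-unique i₀ i₀ (proj₂ (r S.∙ u S.∙ r S.⁻¹))))))))
          (P.trans (φ.homo (r S.∙ u) (r S.⁻¹)) (P.∙-congʳ (φ.homo r u)))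

  module _ {p} (index : HasIndex p) where
    open Inverse index

    -- If `P` has order p^k, its wreath product by the group of cosets has order p^(kp+1), again a
    -- power of `p` since the index is `p`. So whatever `φ` separates, `induced` already separates
    -- on `T`.
    indistinguishable-subgroup : ∀ {x y} → Indistinguishable p T (proj₁ x) (proj₁ y) →
      Indistinguishable p topologicalSubgroup x y
    indistinguishable-subgroup {x} {y} e P φ = induced-reflects index φ {x} {y} (proj₁ (indistinguishable⇒≈
      {P = wreath (FinitePGroup.group P) (Group.isGroup (cosetGroup index))}
      (pPowerSize-× {S = pointwise P.setoid p} {T = ≡.setoid (Fin p)}
        (pPowerSize-pointwise {S = P.setoid} p (FinitePGroup.exponent P , numbered-≡ P.isEquivalence))
        (numbered⇒pPowerSize (numbered-≡ ≡.isEquivalence)))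
      (induced index φ) e))
      where module P = Group (FinitePGroup.group P)

    -- The group of cosets has order `p`, so `cosetHom` is itself one of the homomorphisms that
    -- cannot tell the two points apart.
    member-indistinguishable : Member Respects Indistinguishable p T
    member-indistinguishable {x} {y} e x∈H = ∈-cancel H (C.trans {y} {from (to y)} {x}
      (C.sym {from (to y)} {y} (strictlyInverseʳ y))
      (C.trans {from (to y)} {from (to x)} {x}
        (C.reflexive (≡.cong from (≡.sym same))) (strictlyInverseʳ x))) x∈H
      where
      module C = Setoid rightCosets
      same : to x ≡ to y
      same = indistinguishable⇒≈ {P = cosetGroup index}
        (numbered⇒pPowerSize (numbered-≡ ≡.isEquivalence)) (cosetHom index) e

-- Classes and cochains along a quotient by indistinguishability.

-- T′ is T with the points indistinguishable by finite p-groups identified; the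
-- section σ is only a map of sets, continuous on what respects π.
record PQuotient (p : ℕ) (T T′ : TopologicalGroup ℓ) : Set (lsuc ℓ) where
  private
    module T  = TopologicalGroup T
    module T′ = TopologicalGroup T′
  field
    π             : T.Carrier → T′.Carrier
    σ             : T′.Carrier → T.Carrier
    π-cong        : ∀ {x y} → x T.≈ y → π x T′.≈ π y
    π-homo        : ∀ x y → π (x T.∙ y) T′.≈ π x T′.∙ π y
    π-continuous  : Continuous T.topology T′.topology π
    π-σ           : ∀ y → π (σ y) T′.≈ y
    π-kernel      : ∀ {x y} → π x T′.≈ π y → Indistinguishable p T x y
    σ-continuous  : ∀ {D f} → (∀ {x y} → Indistinguishable p T x y → Setoid._≈_ D (f x) (f y)) →
                    ContinuousToDiscrete T.topology D f → ContinuousToDiscrete T′.topology D (f ∘ σ)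

  σ-cong : ∀ {x y} → x T′.≈ y → Indistinguishable p T (σ x) (σ y)
  σ-cong e = π-kernel (T′.trans (π-σ _) (T′.trans e (T′.sym (π-σ _))))

  -- Multiplicativity up to indistinguishability suffices, as `σ` is only composed with functions
  -- constant on these classes.
  σ-homo : ∀ x y → Indistinguishable p T (σ (x T′.∙ y)) (σ x T.∙ σ y)
  σ-homo x y = π-kernel (T′.trans (π-σ _) (T′.sym
    (T′.trans (π-homo _ _) (T′.∙-cong (π-σ x) (π-σ y)))))

module _ {p : ℕ} .{{_ : NonZero p}} {T T′ : TopologicalGroup ℓ} (Q : PQuotient p T T′) where
  private
    module A  = CommutativeRing (ℤ/ p)
    module T  = TopologicalGroup T
    module T′ = TopologicalGroup T′
  open A using (_+_; _*_; -_; _-_; 0#) renaming (_≈_ to _≈ᴬ_)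
  open PQuotient Q
  open Cohomology p

  inflateC¹ : C¹ T′ → C¹ T
  inflateC¹ f = record
    { ⟦_⟧        = f.⟦_⟧ ∘ π
    ; cong       = f.cong ∘ π-cong
    ; continuous = π-continuous ∘ f.continuous
    }
    where module f = C¹ f

  inflateZ¹ : Z¹ T′ → Z¹ T
  inflateZ¹ α = record
    { cochain   = inflateC¹ α.cochain
    ; isCocycle = λ g h → A.trans
        (A.+-congʳ {x = α.⟦ π g ⟧} (A.+-congˡ {x = α.⟦ π h ⟧} (A.-‿cong (α.cong (π-homo g h)))))
        (α.isCocycle (π g) (π h))
    }
    where module α = Z¹ α

  descendC¹ : (f : C¹ T) → (∀ {x y} → Indistinguishable p T x y → C¹.⟦_⟧ f x ≈ᴬ C¹.⟦_⟧ f y) → C¹ T′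
  descendC¹ f inv = record
    { ⟦_⟧        = f.⟦_⟧ ∘ σ
    ; cong       = inv ∘ σ-cong
    ; continuous = σ-continuous {D = A.setoid} inv f.continuous
    }
    where module f = C¹ f

  descendZ¹ : Z¹ T → Z¹ T′
  descendZ¹ α = record
    { cochain   = descendC¹ α.cochain (cocycle-invariant p α)
    ; isCocycle = λ g h → A.trans
        (A.+-congʳ {x = α.⟦ σ g ⟧} (A.+-congˡ {x = α.⟦ σ h ⟧}
          (A.-‿cong (cocycle-invariant p α (σ-homo g h)))))
        (α.isCocycle (σ g) (σ h))
    }
    where module α = Z¹ α

  -- Every test class `β` on `T` is inflated from `descendZ¹ β`, so the cochain found on `T′` can be
  -- pulled back.
  inflateR : Setoid.Carrier (R T′) → Setoid.Carrier (R T)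
  inflateR (α , r) = inflateZ¹ α , λ β →
    let module α = Z¹ α
        module β = Z¹ β
        (f , δf) = r (descendZ¹ β)
        module f = C¹ f
    in inflateC¹ f , λ g h → begin
      α.⟦ π g ⟧ * β.⟦ h ⟧ - 0#
        ≈⟨ A.+-congʳ {x = - 0#} (A.*-congˡ {x = α.⟦ π g ⟧}
             (cocycle-invariant p β (π-kernel (π-σ (π h))))) ⟨
      α.⟦ π g ⟧ * β.⟦ σ (π h) ⟧ - 0#
        ≈⟨ δf (π g) (π h) ⟩
      f.⟦ π h ⟧ - f.⟦ π g T′.∙ π h ⟧ + f.⟦ π g ⟧
        ≈⟨ A.+-congʳ {x = f.⟦ π g ⟧} (A.+-congˡ {x = f.⟦ π h ⟧} (A.-‿cong (f.cong (π-homo g h)))) ⟨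
      f.⟦ π h ⟧ - f.⟦ π (g T.∙ h) ⟧ + f.⟦ π g ⟧ ∎
    where open SetoidReasoning A.setoid

  -- The cochain `f` found on `T` has to descend as well. It is not a cocycle in general, so
  -- `cup-invariant` is used for it.
  descendR : Setoid.Carrier (R T) → Setoid.Carrier (R T′)
  descendR (α , r) = descendZ¹ α , λ β →
    let module α = Z¹ α
        module β = Z¹ β
        (f , δf) = r (inflateZ¹ β)
        module f = C¹ f
        f-invariant : ∀ {x y} → Indistinguishable p T x y → f.⟦ x ⟧ ≈ᴬ f.⟦ y ⟧
        f-invariant e = proj₂ (proj₂ (cup-invariant p α (inflateZ¹ β) f δf e))
    in descendC¹ f f-invariant , λ g h → begin
      α.⟦ σ g ⟧ * β.⟦ h ⟧ - 0#
        ≈⟨ A.+-congʳ {x = - 0#} (A.*-congˡ {x = α.⟦ σ g ⟧} (β.cong (π-σ h))) ⟨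
      α.⟦ σ g ⟧ * β.⟦ π (σ h) ⟧ - 0#
        ≈⟨ δf (σ g) (σ h) ⟩
      f.⟦ σ h ⟧ - f.⟦ σ g T.∙ σ h ⟧ + f.⟦ σ g ⟧
        ≈⟨ A.+-congʳ {x = f.⟦ σ g ⟧} (A.+-congˡ {x = f.⟦ σ h ⟧} (A.-‿cong (f-invariant (σ-homo g h)))) ⟨
      f.⟦ σ h ⟧ - f.⟦ σ (g T′.∙ h) ⟧ + f.⟦ σ g ⟧ ∎
    where open SetoidReasoning A.setoid

-- The quotients of G and of its subgroups inside G(p).

module _ (p : ℕ) (G : ProfiniteGroup ℓ) where
  private
    module G  = ProfiniteGroup G
    Gₚ = maximalProPQuotient p G
    module Q  = ProfiniteGroup Gₚ

  -- G(p) is encoded on the elements of G, so both maps are the identity and only equality and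
  -- topology change.
  groupQuotient : PQuotient p G.topologicalGroup Q.topologicalGroup
  groupQuotient = record
    { π             = id
    ; σ             = id
    ; π-cong        = λ e P φ → ContinuousHom.⟦⟧-cong φ e
    ; π-homo        = λ _ _ → Q.refl
    ; π-continuous  = proj₂
    ; π-σ           = λ _ → Q.refl
    ; π-kernel      = id
    ; σ-continuous  = λ {D} inv cf d →
        (λ e (lift eq) → lift (Setoid.trans D (Setoid.sym D (inv e)) eq)) , cf d
    }

  preimage : OpenSubgroup Q.topologicalGroup → OpenSubgroup G.topologicalGroup
  preimage H = record
    { Member    = Member
    ; isOpen    = proj₂ isOpen
    ; ε-closed  = ε-closed
    ; ∙-closed  = ∙-closed
    ; ⁻¹-closed = ⁻¹-closed
    }
    where open OpenSubgroup H

  saturated : (H : OpenSubgroup G.topologicalGroup) → OpenSubgroup.Member H Respects Q._≈_ →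
    OpenSubgroup Q.topologicalGroup
  saturated H resp≈ = record
    { Member    = Member
    ; isOpen    = resp≈ , isOpen
    ; ε-closed  = ε-closed
    ; ∙-closed  = ∙-closed
    ; ⁻¹-closed = ⁻¹-closed
    }
    where open OpenSubgroup H

  module _ (H : OpenSubgroup Q.topologicalGroup) where
    private
      module H  = OpenSubgroup H
      module H⁻ = OpenSubgroup (preimage H)

    preimage-index : ∀ {n} → H.HasIndex n → H⁻.HasIndex n
    preimage-index i = record
      { to = to ; from = from ; to-cong = to-cong ; from-cong = from-cong ; inverse = inverse }
      where open Inverse i

    image-index : ∀ {n} → H⁻.HasIndex n → H.HasIndex n
    image-index i = record
      { to = to ; from = from ; to-cong = to-cong ; from-cong = from-cong ; inverse = inverse }
      where open Inverse i

    -- Equality in `H` refers to homomorphisms on all of G, but `π-kernel` to those on the preimage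
    -- alone; `indistinguishable-subgroup` bridges the two.
    subgroupQuotient : H⁻.Normal → H⁻.HasIndex p →
      PQuotient p H⁻.topologicalSubgroup H.topologicalSubgroup
    subgroupQuotient normal index = record
      { π             = id
      ; σ             = id
      ; π-cong        = λ e P φ → ContinuousHom.⟦⟧-cong φ e
      ; π-homo        = λ _ _ → Q.refl
      ; π-continuous  = λ (r , (_ , oW)) →
          (λ e → r (λ P φ → ContinuousHom.⟦⟧-cong φ e)) , oW
      ; π-σ           = λ _ → Q.refl
      ; π-kernel      = λ {x} {y} → indist {x} {y}
      ; σ-continuous  = λ {D} {f} inv cf d →
          (λ {x} {y} e (lift eq) → lift (Setoid.trans D
             (Setoid.sym D (inv {x} {y} (indist {x} {y} e))) eq)) ,
          (λ {x} {y} e (m , lift eq) → H.resp e m , lift (Setoid.trans D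
             (inv {y , H.resp e m} {x , m} (indist {y , H.resp e m} {x , m} (Q.sym e))) eq)) ,
          proj₂ (cf d)
      }
      where
      indist : ∀ {x y : Σ _ H⁻.Member} → proj₁ x Q.≈ proj₁ y →
               Indistinguishable p H⁻.topologicalSubgroup x y
      indist {x} {y} = indistinguishable-subgroup (preimage H) normal index {x} {y}

-- Corestriction and the Kijima-Nishi property on both sides.

module _ {p : ℕ} .{{_ : NonZero p}} (G : ProfiniteGroup ℓ) where
  private
    module G  = ProfiniteGroup G
    Gₚ = maximalProPQuotient p G
    module Q  = ProfiniteGroup Gₚ
    module A  = CommutativeRing (ℤ/ p)
  open Cohomology p
  open CommutativeMonoidSum A.+-commutativeMonoid using (sum-cong-≋)

  module _ (H : OpenSubgroup Q.topologicalGroup) {n} (index : OpenSubgroup.HasIndex H n) where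
    private
      module Cor = Corestriction H index
      module Cor′ = Corestriction (preimage p G H) (preimage-index p G H index)

    -- The same numbering gives the same coset representatives, so the two sums agree term by term.
    cor-preimage : (γ : Z¹ (OpenSubgroup.topologicalSubgroup H))
      (γ′ : Z¹ (OpenSubgroup.topologicalSubgroup (preimage p G H))) →
      (∀ u → Z¹.⟦_⟧ γ u A.≈ Z¹.⟦_⟧ γ′ u) →
      ∀ g → Z¹.⟦_⟧ (Cor.cor γ) g A.≈ Z¹.⟦_⟧ (Cor′.cor γ′) g
    cor-preimage γ γ′ e g = sum-cong-≋ {n}
      {λ i → Z¹.⟦_⟧ γ (Cor.factor i g)} {λ i → Z¹.⟦_⟧ γ′ (Cor′.factor i g)}
      (λ i → A.trans (e (Cor.factor i g))
        (Z¹.cong γ′ {Cor.factor i g} {Cor′.factor i g} G.refl))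

  -- Inflate `α` to G, find a preimage under corestriction there, and descend it to `H`.
  kijimaNishi-quotient : KijimaNishi p G → KijimaNishi p Gₚ
  kijimaNishi-quotient kn H normal index α = γ , λ g → A.trans
    (cor-preimage H index (proj₁ γ) (proj₁ γ′) (λ _ → A.refl) g) (proj₂ lifted g)
    where
    index′ = preimage-index p G H index
    lifted = kn (preimage p G H) normal index′ (inflateR (groupQuotient p G) α)
    γ′ = proj₁ lifted
    γ = descendR (subgroupQuotient p G H normal index′) γ′

  kijimaNishi-lift : KijimaNishi p Gₚ → KijimaNishi p G
  kijimaNishi-lift kn H normal index α = γ′ , λ g → A.trans
    (A.sym (cor-preimage H′ index′ (proj₁ γ) (proj₁ γ′) (λ _ → A.refl) g)) (proj₂ lifted g)
    where
    -- The preimage of `H′` is `H` again by η, so the inflated class `γ′` lives on `H` without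
    -- conversion.
    H′ = saturated p G H (member-indistinguishable H normal index)
    index′ = image-index p G H′ index
    lifted = kn H′ normal index′ (descendR (groupQuotient p G) α)
    γ = proj₁ lifted
    γ′ = inflateR (subgroupQuotient p G H′ normal index) γ

proposition1p12 : ∀ {ℓ} (p : ℕ) → Prime p → (G : ProfiniteGroup ℓ) →
    KijimaNishi p G ⇔ KijimaNishi p (maximalProPQuotient p G)
proposition1p12 p p-prime G = mk⇔ (kijimaNishi-quotient G) (kijimaNishi-lift G)
  where instance _ = prime⇒nonZero p-prime
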